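{- Let $n \geq 5$ and $k \geq 2$ be integers with $k < n/2$, and let $\pi = (d_1 \leq \cdots \leq d_n)$ be a graphical sequence such that $d_1 = \cdots = d_k = k$ and $d_{k+1} = \cdots = d_{n-k+1} = n-k-1$. Then $\pi$ is forcibly hamiltonian unless $d_j = n-k-1$ for all $j$ with $n-k+2 \leq j \leq n-1$ and $d_n = n-1$.
   Context: A sequence of nonnegative integers is graphical if it is the degree sequence of some finite simple graph. A graphical sequence $\pi$ is forcibly hamiltonian if every simple graph with degree sequence $\pi$ is hamiltonian (has a cycle through all vertices). -}

module Defs where

open import Data.Nat using (ℕ; zero; suc; _+_; _∸_; _≤_; _<_)
open import Data.Bool using (Bool; true; false; if_then_else_)
open import Data.Fin using (Fin; toℕ)
open import Data.Fin.Permutation using (Permutation′; _⟨$⟩ʳ_)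
open import Data.List using (List; map; allFin)
open import Data.Nat.ListAction using (sum)
open import Data.Product using (Σ; ∃; _×_)
open import Relation.Binary.PropositionalEquality using (_≡_)
open import Relation.Nullary using (¬_)

record SimpleGraph (n : ℕ) : Set where
  field
    adj   : Fin n → Fin n → Bool
    sym   : ∀ i j → adj i j ≡ adj j i
    irref : ∀ i → adj i i ≡ false
open SimpleGraph public

degree : ∀ {n} → SimpleGraph n → Fin n → ℕ
degree {n} G i = sum (map (λ j → if adj G i j then 1 else 0) (allFin n))

HasDegreeSeq : ∀ {n} → SimpleGraph n → (Fin n → ℕ) → Set
HasDegreeSeq G π = ∀ i → degree G i ≡ π i

Graphical : ∀ {n} → (Fin n → ℕ) → Set
Graphical {n} π = Σ (SimpleGraph n) λ G → HasDegreeSeq G π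

Hamiltonian : ∀ {n} → SimpleGraph n → Set
Hamiltonian {n} G =
  3 ≤ n × Σ (Permutation′ n) λ σ →
    (∀ i j → toℕ j ≡ suc (toℕ i) → adj G (σ ⟨$⟩ʳ i) (σ ⟨$⟩ʳ j) ≡ true)
    × (∀ i j → toℕ i ≡ n ∸ 1 → toℕ j ≡ 0 → adj G (σ ⟨$⟩ʳ i) (σ ⟨$⟩ʳ j) ≡ true)

ForciblyHamiltonian : ∀ {n} → (Fin n → ℕ) → Set
ForciblyHamiltonian {n} π = (G : SimpleGraph n) → HasDegreeSeq G π → Hamiltonian G

Nondecreasing : ∀ {n} → (Fin n → ℕ) → Set
Nondecreasing π = ∀ i j → toℕ i ≤ toℕ j → π i ≤ π j

{-# OPTIONS --safe #-}
module Submission where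

-- Let A be the k vertices of degree k and write n = k + m + 1, so that the other vertices have degree at
-- least m, and at most k − 1 vertices have degree above m.  Suppose G has no Hamiltonian cycle.
--
-- If m > k, the Bondy–Chvátal closure makes the complement of A a clique and joins to all of A every
-- vertex outside A that has a neighbour in A (a hub).  The vertices of A gain no neighbour, otherwise the
-- closure would be complete; hence hubs were already joined to A in G, non-hubs outside A to everything
-- outside A, and s hubs have degree at least n − s each.  This forces s < k.  For 2 ≤ s < k, Dirac's
-- theorem on A and all hubs but one gives a cycle that extends to a Hamiltonian one; s = 1 is the exception.
--
-- If m = k, all degrees are at least (n − 1) / 2, so there is a Hamiltonian path, and along it the
-- neighbourhoods of its ends q and p are complementary (p ~ c iff not q ~ d, for consecutive c, d).
-- Either the neighbours of q are an initial segment, which yields two k-cliques sharing a universal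
-- neighbour, the exception; or there is a cycle missing one vertex, which yields an independent set of
-- k + 1 vertices joined to the k others, all of which would have degree above k.

open import Defs
open import Data.Bool using (Bool; true; false; if_then_else_; not; _∧_; _∨_; _≟_)
open import Data.Bool.Properties using (∨-zeroʳ; not-involutive; T-≡; ∧-zeroʳ)
open import Data.Empty using (⊥; ⊥-elim)
open import Data.Fin using (Fin; toℕ; cast; fromℕ<) renaming (zero to fzero; suc to fsuc)
open import Data.Fin.Properties using (toℕ-injective; toℕ-fromℕ<; toℕ<n; toℕ-cast; cast-involutive) renaming (_≟_ to _≟ᶠ_)
open import Data.Fin.Permutation using (Permutation′; _⟨$⟩ʳ_; _∘ₚ_; cast-id)
open import Data.List using (List; []; _∷_; [_]; _++_; _∷ʳ_; map; length; reverse; allFin; tabulate; lookup; initLast; _∷ʳ′_)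
open import Data.List.Properties using (map-++; map-∘; unfold-reverse; ++-assoc; length-map; length-++; map-cong; length-tabulate; lookup-tabulate; ∷ʳ-++; map-tabulate)
open import Data.List.Membership.Propositional using (_∈_)
open import Data.List.Membership.Propositional.Properties using (∈-map⁺; ∈-∃++; ∈-allFin; ∈-++⁺ʳ; ∈-++⁺ˡ; ∈-++⁻; ∈-map⁻)
open import Data.List.Relation.Binary.Permutation.Propositional using (_↭_; ↭⇒↭ₛ; ↭-sym; ↭-trans; ↭-refl; ↭-prep; ↭-reflexive; module PermutationReasoning)
import Data.List.Relation.Binary.Permutation.Propositional.Properties as Perm
open import Data.List.Relation.Binary.Permutation.Homogeneous using (onIndices)
open import Data.List.Relation.Binary.Permutation.Setoid.Properties using (onIndices-lookup; Unique-resp-↭)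
open import Data.List.Relation.Unary.All as All using (All; []; _∷_)
import Data.List.Relation.Unary.All.Properties as Allₚ
open import Data.List.Relation.Unary.AllPairs as AllPairs using ([]; _∷_)
open import Data.List.Relation.Unary.Unique.Propositional using (Unique)
open import Data.List.Relation.Unary.Unique.Propositional.Properties using (allFin⁺)
open import Data.List.Relation.Unary.Any using (here; there)
open import Data.Nat using (ℕ; zero; suc; _+_; _*_; _∸_; _≤_; _<_; z≤n; s≤s; _≤ᵇ_; _<?_; _<ᵇ_; pred; >-nonZero)
open import Data.Nat.ListAction using (sum)
open import Data.Nat.ListAction.Properties using (sum-++; sum-↭)
open import Data.Nat.Properties hiding (_≟_)
open import Data.Nat.Tactic.RingSolver using (solve-∀)
open import Data.Product using (∃; ∃₂; _×_; _,_; proj₁; proj₂; swap)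
open import Data.Sum using (_⊎_; inj₁; inj₂)
open import Function using (_∘_; const; Equivalence)
open import Relation.Binary.PropositionalEquality using (_≡_; _≢_; refl; cong; cong₂; subst; trans; module ≡-Reasoning) renaming (sym to ≡-sym; setoid to ≡-setoid)
open import Relation.Nullary using (¬_; Dec; yes; no; does; contradiction)
open import Relation.Nullary.Decidable using (map′; _⊎-dec_; dec-true; dec-false)

private
  variable
    X Y : Set
    n : ℕ

-- Counting with Boolean predicates on lists

⟦_⟧ : Bool → ℕ
⟦ b ⟧ = if b then 1 else 0

count : (X → Bool) → List X → ℕ
count p xs = sum (map (λ x → if p x then 1 else 0) xs)

count-++ : ∀ (p : X → Bool) xs ys → count p (xs ++ ys) ≡ count p xs + count p ys
count-++ p xs ys = trans (cong sum (map-++ _ xs ys)) (sum-++ (map _ xs) _)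

count-↭ : ∀ (p : X → Bool) {xs ys} → xs ↭ ys → count p xs ≡ count p ys
count-↭ p σ = sum-↭ (Perm.map⁺ _ σ)

count-map : ∀ (p : Y → Bool) (f : X → Y) xs → count p (map f xs) ≡ count (p ∘ f) xs
count-map p f xs = cong sum (≡-sym (map-∘ xs))

⟦⟧-mono : ∀ {a b} → (a ≡ true → b ≡ true) → ⟦ a ⟧ ≤ ⟦ b ⟧
⟦⟧-mono {false} h = z≤n
⟦⟧-mono {true}  h rewrite h refl = ≤-refl

count-mono : ∀ {p q : X → Bool} xs → (∀ {x} → x ∈ xs → p x ≡ true → q x ≡ true) → count p xs ≤ count q xs
count-mono []       h = z≤n
count-mono (x ∷ xs) h = +-mono-≤ (⟦⟧-mono (h (here refl))) (count-mono xs (h ∘ there))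

count-not : ∀ (p : X → Bool) xs → count p xs + count (not ∘ p) xs ≡ length xs
count-not p []       = refl
count-not p (x ∷ xs) with p x
... | true  = cong suc (count-not p xs)
... | false = trans (+-suc _ _) (cong suc (count-not p xs))

count≤length : ∀ (p : X → Bool) xs → count p xs ≤ length xs
count≤length p xs = m+n≤o⇒m≤o _ (≤-reflexive (count-not p xs))

count-true : ∀ (xs : List X) → count (const true) xs ≡ length xs
count-true []       = refl
count-true (x ∷ xs) = cong suc (count-true xs)

count-∈ : ∀ (p : X → Bool) {x xs} → x ∈ xs → p x ≡ true → 0 < count p xs
count-∈ p (here refl) px rewrite px = s≤s z≤n
count-∈ p (there x∈)  px = ≤-trans (count-∈ p x∈ px) (m≤n+m _ _)

count-∃ : ∀ (p : X → Bool) xs → 0 < count p xs → ∃ λ x → x ∈ xs × p x ≡ true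
count-∃ p (x ∷ xs) h with p x in eq
... | true  = x , here refl , eq
... | false with y , y∈ , py ← count-∃ p xs h = y , there y∈ , py

count-∉ : ∀ (p : X → Bool) {x xs} → x ∈ xs → p x ≡ false → count p xs < length xs
count-∉ p {xs = xs} x∈ px = begin-strict
  count p xs                          <⟨ m<m+n (count p xs) (count-∈ (not ∘ p) x∈ (cong not px)) ⟩
  count p xs + count (not ∘ p) xs     ≡⟨ count-not p xs ⟩
  length xs                           ∎
  where open ≤-Reasoning

-- No element loses in passing from `p` to `q`, so if the total does not grow, none gains. This
-- turns tight degree counts into equalities of neighbourhoods.
count-rigid : ∀ {p q : X → Bool} xs → (∀ {x} → x ∈ xs → p x ≡ true → q x ≡ true) →
  count q xs ≤ count p xs → ∀ {x} → x ∈ xs → q x ≡ true → p x ≡ true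
count-rigid {p = p} {q} (y ∷ xs) h le (here refl) qx with p y in eq
... | true  = refl
... | false rewrite qx = contradiction (≤-trans le (count-mono xs (h ∘ there))) (<-irrefl refl)
count-rigid {p = p} {q} (y ∷ xs) h le (there x∈) qx =
  count-rigid xs (h ∘ there)
    (+-cancelˡ-≤ ⟦ p y ⟧ _ _ (≤-trans (+-monoˡ-≤ _ (⟦⟧-mono (h (here refl)))) le)) x∈ qx

count-∨ : ∀ (p q : X → Bool) xs → count (λ x → p x ∨ q x) xs ≤ count p xs + count q xs
count-∨ p q []       = z≤n
count-∨ p q (x ∷ xs) with p x | q x
... | true  | true  = s≤s (≤-trans (count-∨ p q xs) (+-monoʳ-≤ (count p xs) (n≤1+n _)))
... | true  | false = s≤s (count-∨ p q xs)
... | false | true  = ≤-trans (s≤s (count-∨ p q xs)) (≤-reflexive (≡-sym (+-suc _ _)))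
... | false | false = count-∨ p q xs

count-disjoint : ∀ (p q : X → Bool) xs → (∀ x → p x ≡ true → q x ≡ false) →
  count p xs + count q xs ≤ count (λ x → p x ∨ q x) xs
count-disjoint p q []       h = z≤n
count-disjoint p q (x ∷ xs) h with p x in px
... | true  rewrite h x px = s≤s (count-disjoint p q xs h)
... | false with q x
...   | true  = ≤-trans (≤-reflexive (+-suc _ _)) (s≤s (count-disjoint p q xs h))
...   | false = count-disjoint p q xs h

-- Otherwise the termwise inequalities add up to the opposite one. In use, `a` and `b` record
-- adjacency to the two ends of a gap, and the element found is a place where a 2-opt move gains.
pigeonhole : ∀ (a b c : X → Bool) xs → count c xs < count a xs + count b xs →
  ∃ λ x → x ∈ xs × ⟦ c x ⟧ < ⟦ a x ⟧ + ⟦ b x ⟧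
pigeonhole a b c (x ∷ xs) h with ⟦ c x ⟧ <? ⟦ a x ⟧ + ⟦ b x ⟧
... | yes lt = x , here refl , lt
... | no ¬lt with count c xs <? count a xs + count b xs
...   | yes lt with y , y∈ , r ← pigeonhole a b c xs lt = y , there y∈ , r
...   | no ¬lt′ = contradiction h (≤⇒≯ (≤-trans (≤-reflexive (interchange ⟦ a x ⟧ _ ⟦ b x ⟧ _))
                    (+-mono-≤ (≮⇒≥ ¬lt) (≮⇒≥ ¬lt′))))
  where
  interchange : ∀ s t u v → (s + t) + (u + v) ≡ (s + u) + (t + v)
  interchange = solve-∀

count-all : ∀ (p : X → Bool) xs → (∀ {x} → x ∈ xs → p x ≡ true) → count p xs ≡ length xs
count-all p []       h = refl
count-all p (x ∷ xs) h rewrite h (here refl) = cong suc (count-all p xs (h ∘ there))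

count-none : ∀ (p : X → Bool) xs → (∀ {x} → x ∈ xs → p x ≡ false) → count p xs ≡ 0
count-none p []       h = refl
count-none p (x ∷ xs) h rewrite h (here refl) = count-none p xs (h ∘ there)

-- Walks

-- The consecutive pairs of the walk u, ds, v; the closed walk on w ∷ ws is pairs w ws w.
pairs : X → List X → X → List (X × X)
pairs u []       v = [ u , v ]
pairs u (d ∷ ds) v = (u , d) ∷ pairs d ds v

pairs-++ : ∀ (u : X) ds {y} es {v} → pairs u (ds ++ y ∷ es) v ≡ pairs u ds y ++ pairs y es v
pairs-++ u []       es = refl
pairs-++ u (d ∷ ds) es = cong (_ ∷_) (pairs-++ d ds es)

pairs-proj₁ : ∀ (u : X) ds {v} → map proj₁ (pairs u ds v) ≡ u ∷ ds
pairs-proj₁ u []       = refl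
pairs-proj₁ u (d ∷ ds) = cong (u ∷_) (pairs-proj₁ d ds)

pairs-proj₂ : ∀ (u : X) ds {v} → map proj₂ (pairs u ds v) ≡ ds ∷ʳ v
pairs-proj₂ u []       = refl
pairs-proj₂ u (d ∷ ds) = cong (d ∷_) (pairs-proj₂ d ds)

length-pairs : ∀ (u : X) ds {v} → length (pairs u ds v) ≡ suc (length ds)
length-pairs u ds {v} = trans (≡-sym (length-map proj₁ (pairs u ds v))) (cong length (pairs-proj₁ u ds))

pairs-reverse : ∀ (u : X) ds {v} → pairs v (reverse ds) u ↭ map swap (pairs u ds v)
pairs-reverse u []           = ↭-refl
pairs-reverse u (d ∷ ds) {v} = begin
  pairs v (reverse (d ∷ ds)) u         ≡⟨ cong (λ z → pairs v z u) (unfold-reverse d ds) ⟩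
  pairs v (reverse ds ∷ʳ d) u          ≡⟨ pairs-++ v (reverse ds) [] ⟩
  pairs v (reverse ds) d ∷ʳ (d , u)    ↭⟨ Perm.∷↭∷ʳ _ _ ⟨
  (d , u) ∷ pairs v (reverse ds) d     ↭⟨ ↭-prep _ (pairs-reverse d ds) ⟩
  (d , u) ∷ map swap (pairs d ds v)    ∎
  where open PermutationReasoning

rotate-pairs : ∀ (w : X) as y bs → pairs y (bs ++ w ∷ as) y ↭ pairs w (as ++ y ∷ bs) w
rotate-pairs w as y bs = begin
  pairs y (bs ++ w ∷ as) y        ≡⟨ pairs-++ y bs as ⟩
  pairs y bs w ++ pairs w as y    ↭⟨ Perm.++-comm (pairs y bs w) _ ⟩
  pairs w as y ++ pairs y bs w    ≡⟨ pairs-++ w as bs ⟨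
  pairs w (as ++ y ∷ bs) w        ∎
  where open PermutationReasoning

rotate-list : ∀ (w : X) as y bs → y ∷ (bs ++ w ∷ as) ↭ w ∷ (as ++ y ∷ bs)
rotate-list w as y bs = Perm.++-comm (y ∷ bs) (w ∷ as)

count-cycle₁ : ∀ (f : X → Bool) w ws → count (f ∘ proj₁) (pairs w ws w) ≡ count f (w ∷ ws)
count-cycle₁ f w ws = trans (≡-sym (count-map f proj₁ (pairs w ws w))) (cong (count f) (pairs-proj₁ w ws))

count-cycle₂ : ∀ (f : X → Bool) w ws → count (f ∘ proj₂) (pairs w ws w) ≡ count f (w ∷ ws)
count-cycle₂ f w ws = trans (≡-sym (count-map f proj₂ (pairs w ws w)))
  (trans (cong (count f) (pairs-proj₂ w ws)) (count-↭ f (↭-sym (Perm.∷↭∷ʳ w ws))))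

-- The ends `u` and `v` are not in the list of inner vertices, so consecutive pairs touching an end
-- need their own cases.
data Located {X : Set} : X → List X → X → X → X → Set where
  only  : ∀ {u v} → Located u [] v u v
  first : ∀ {u d v} bs → Located u (d ∷ bs) v u d
  mid   : ∀ {u c d v} as bs → Located u (as ++ c ∷ d ∷ bs) v c d
  last  : ∀ {u c v} as → Located u (as ∷ʳ c) v c v

locate : ∀ {u : X} ds {v c d} → (c , d) ∈ pairs u ds v → Located u ds v c d
locate []       (here refl) = only
locate (e ∷ ds) (here refl) = first ds
locate (e ∷ ds) (there m) with locate ds m
... | only     = last []
... | first bs = mid [] bs
... | mid as bs = mid (e ∷ as) bs
... | last as   = last (e ∷ as)

rotate-to-pair : ∀ {w : X} ws {c d} → ws ≢ [] → (c , d) ∈ pairs w ws w →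
  ∃ λ es → (c ∷ d ∷ es ↭ w ∷ ws) × (pairs c (d ∷ es) c ↭ pairs w ws w)
rotate-to-pair {w = w} ws ne m with locate ws m
... | only      = contradiction refl ne
... | first bs  = bs , ↭-refl , ↭-refl
... | mid {c = c} {d} as bs = bs ++ w ∷ as , rotate-list w as c (d ∷ bs) , rotate-pairs w as c (d ∷ bs)
... | last {c = c} as       = as , rotate-list w as c [] , rotate-pairs w as c []

count-pairs-reverse : ∀ (f : X × X → Bool) → (∀ e → f (swap e) ≡ f e) → ∀ u ds {v} →
  count f (pairs v (reverse ds) u) ≡ count f (pairs u ds v)
count-pairs-reverse f f-sym u ds {v} = begin
  count f (pairs v (reverse ds) u)         ≡⟨ count-↭ f (pairs-reverse u ds) ⟩
  count f (map swap (pairs u ds v))        ≡⟨ count-map f swap (pairs u ds v) ⟩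
  count (f ∘ swap) (pairs u ds v)          ≡⟨ cong sum (map-cong (λ e → cong ⟦_⟧ (f-sym e)) (pairs u ds v)) ⟩
  count f (pairs u ds v)                   ∎
  where open ≡-Reasoning

count-pairs-++ : ∀ (f : X × X → Bool) u ds {y} es {v} →
  count f (pairs u (ds ++ y ∷ es) v) ≡ count f (pairs u ds y) + count f (pairs y es v)
count-pairs-++ f u ds es = trans (cong (count f) (pairs-++ u ds es)) (count-++ f (pairs u ds _) _)

reverse-segment : ∀ (q : X) as c bs → c ∷ reverse as ++ q ∷ bs ↭ q ∷ as ++ c ∷ bs
reverse-segment q as c bs = begin
  c ∷ reverse as ++ q ∷ bs   ↭⟨ ↭-prep c (Perm.++⁺ʳ (q ∷ bs) (Perm.↭-reverse as)) ⟩
  c ∷ as ++ q ∷ bs           ↭⟨ ↭-prep c (Perm.shift q as bs) ⟩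
  c ∷ q ∷ as ++ bs           ↭⟨ Perm.shift c (q ∷ as) bs ⟨
  q ∷ as ++ c ∷ bs           ∎
  where open PermutationReasoning

-- The 2-opt move: reversing the segment from q to c trades the pairs (p , q) and (c , d)
-- of a closed walk for (p , c) and (q , d).
two-opt : ∀ {p q : X} ys {c d} → (c , d) ∈ pairs q ys p →
  ∃₂ λ w ws → (w ∷ ws ↭ p ∷ q ∷ ys) ×
    (∀ (f : X × X → Bool) → (∀ e → f (swap e) ≡ f e) →
      count f (pairs w ws w) + (⟦ f (p , q) ⟧ + ⟦ f (c , d) ⟧)
        ≡ count f (pairs p (q ∷ ys) p) + (⟦ f (p , c) ⟧ + ⟦ f (q , d) ⟧))
two-opt {X = X} {p} {q} ys m with locate ys m
-- When `c` is `q` or `d` is `p`, the pairs created are those destroyed up to orientation, so the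
-- walk is kept.
... | only     = p , q ∷ ys , ↭-refl , λ f f-sym → refl
... | first bs = p , q ∷ ys , ↭-refl , λ f f-sym → refl
... | last {c = c} as = p , q ∷ ys , ↭-refl , λ f f-sym →
  cong (count f (pairs p (q ∷ ys) p) +_)
    (trans (+-comm ⟦ f (p , q) ⟧ _) (cong₂ (λ a b → ⟦ a ⟧ + ⟦ b ⟧) (f-sym (p , c)) (f-sym (q , p))))
... | mid {c = c} {d} as bs = p , c ∷ reverse as ++ q ∷ d ∷ bs , ↭-prep p (reverse-segment q as c (d ∷ bs)) , balance
  where
  ring : ∀ pc r qd t pq cd → (pc + (r + (qd + t))) + (pq + cd) ≡ (pq + (r + (cd + t))) + (pc + qd)
  ring = solve-∀
  -- `f` stays arbitrary because one move has to be tracked both for gaps and for ineligible pairs.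
  balance : ∀ (f : X × X → Bool) → (∀ e → f (swap e) ≡ f e) →
    count f (pairs p (c ∷ reverse as ++ q ∷ d ∷ bs) p) + (⟦ f (p , q) ⟧ + ⟦ f (c , d) ⟧)
      ≡ count f (pairs p (q ∷ as ++ c ∷ d ∷ bs) p) + (⟦ f (p , c) ⟧ + ⟦ f (q , d) ⟧)
  balance f f-sym
    rewrite count-pairs-++ f c (reverse as) {q} (d ∷ bs) {p}
          | count-pairs-reverse f f-sym q as {c}
          | count-pairs-++ f q as {c} (d ∷ bs) {p} =
    ring ⟦ f (p , c) ⟧ (count f (pairs q as c)) ⟦ f (q , d) ⟧ _ ⟦ f (p , q) ⟧ ⟦ f (c , d) ⟧

-- Paths and cycles in a graph, and their improvement by 2-opt moves

edge : SimpleGraph n → Fin n × Fin n → Bool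
edge G (x , y) = adj G x y

Path : SimpleGraph n → Fin n → List (Fin n) → Fin n → Set
Path G u ds v = All (λ e → edge G e ≡ true) (pairs u ds v)

-- Taken on a list so that cycles through only part of the vertices are covered. On two vertices it
-- is an edge traversed both ways.
Cycle : SimpleGraph n → List (Fin n) → Set
Cycle G L = ∃₂ λ w ws → (w ∷ ws ↭ L) × Path G w ws w

gaps : SimpleGraph n → List (Fin n × Fin n) → ℕ
gaps G = count (not ∘ edge G)

gap-sym : ∀ (G : SimpleGraph n) e → not (edge G (swap e)) ≡ not (edge G e)
gap-sym G (x , y) = cong not (sym G y x)

true≢false : ∀ {b} → b ≡ true → b ≡ false → ⊥
true≢false refl ()

count-not-zero : ∀ (p : X → Bool) xs → count (not ∘ p) xs ≡ 0 → All (λ x → p x ≡ true) xs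
count-not-zero p xs eq = All.tabulate λ {x} x∈ → decide x x∈ (p x) refl
  where
  decide : ∀ x → x ∈ xs → ∀ b → p x ≡ b → p x ≡ true
  decide x x∈ true  px = px
  decide x x∈ false px = contradiction (count-∈ (not ∘ p) x∈ (cong not px)) (<-irrefl (≡-sym eq))

all⇒count-not : ∀ (p : X → Bool) {xs} → All (λ x → p x ≡ true) xs → count (not ∘ p) xs ≡ 0
all⇒count-not p []         = refl
all⇒count-not p (px ∷ pxs) rewrite px = all⇒count-not p pxs

reverse-path : ∀ (G : SimpleGraph n) u ds {v} → Path G u ds v → Path G v (reverse ds) u
reverse-path G u ds pth = count-not-zero (edge G) _
  (trans (count-pairs-reverse (not ∘ edge G) (gap-sym G) u ds) (all⇒count-not (edge G) pth))

path-++ : ∀ (G : SimpleGraph n) u ds {y} es {v} → Path G u ds y → Path G y es v → Path G u (ds ++ y ∷ es) v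
path-++ G u ds es p₁ p₂ = subst (All _) (≡-sym (pairs-++ u ds es)) (Allₚ.++⁺ p₁ p₂)

path-split : ∀ (G : SimpleGraph n) u ds {y} es {v} → Path G u (ds ++ y ∷ es) v → Path G u ds y × Path G y es v
path-split G u ds es pth = Allₚ.++⁻ (pairs u ds _) (subst (All _) (pairs-++ u ds es) pth)

replace-start : ∀ (G : SimpleGraph n) {u u′} ds {v} → All (λ x → adj G u′ x ≡ true) (ds ∷ʳ v) →
  Path G u ds v → Path G u′ ds v
replace-start G []       (h ∷ _) (_ ∷ p) = h ∷ p
replace-start G (d ∷ ds) (h ∷ _) (_ ∷ p) = h ∷ p

-- Along the walk from `q` to `p` the first components run through all of `L` but `p`, the second
-- ones through all but `q`, and neither end is its own neighbour. Both degrees become counts over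
-- the same pairs.
end-degrees : ∀ (G : SimpleGraph n) {L p q es} → p ∷ q ∷ es ↭ L →
  count (adj G p) L + count (adj G q) L
    ≡ count (adj G p ∘ proj₁) (pairs q es p) + count (adj G q ∘ proj₂) (pairs q es p)
end-degrees G {L} {p} {q} {es} σ = cong₂ _+_ deg-p deg-q
  where
  open ≡-Reasoning
  deg-p : count (adj G p) L ≡ count (adj G p ∘ proj₁) (pairs q es p)
  deg-p = begin
    count (adj G p) L                                ≡⟨ count-↭ (adj G p) σ ⟨
    ⟦ adj G p p ⟧ + count (adj G p) (q ∷ es)         ≡⟨ cong (λ b → ⟦ b ⟧ + count (adj G p) (q ∷ es)) (irref G p) ⟩
    count (adj G p) (q ∷ es)                         ≡⟨ cong (count (adj G p)) (pairs-proj₁ q es) ⟨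
    count (adj G p) (map proj₁ (pairs q es p))       ≡⟨ count-map (adj G p) proj₁ (pairs q es p) ⟩
    count (adj G p ∘ proj₁) (pairs q es p)           ∎
  deg-q : count (adj G q) L ≡ count (adj G q ∘ proj₂) (pairs q es p)
  deg-q = begin
    count (adj G q) L                                ≡⟨ count-↭ (adj G q) σ ⟨
    count (adj G q) (p ∷ q ∷ es)                     ≡⟨ count-↭ (adj G q) (Perm.∷↭∷ʳ p (q ∷ es)) ⟩
    ⟦ adj G q q ⟧ + count (adj G q) (es ∷ʳ p)        ≡⟨ cong (λ b → ⟦ b ⟧ + count (adj G q) (es ∷ʳ p)) (irref G q) ⟩
    count (adj G q) (es ∷ʳ p)                        ≡⟨ cong (count (adj G q)) (pairs-proj₂ q es) ⟨
    count (adj G q) (map proj₂ (pairs q es p))       ≡⟨ count-map (adj G q) proj₂ (pairs q es p) ⟩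
    count (adj G q ∘ proj₂) (pairs q es p)           ∎

-- The edges together with the pairs satisfying Ore's degree condition. Degrees are taken within
-- `L`, so that the argument also serves induced subgraphs.
Eligible : SimpleGraph n → List (Fin n) → Fin n × Fin n → Bool
Eligible G L (x , y) = adj G x y ∨ (length L ≤ᵇ count (adj G x) L + count (adj G y) L)

eligible-sym : ∀ (G : SimpleGraph n) L e → Eligible G L (swap e) ≡ Eligible G L e
eligible-sym G L (x , y) = cong₂ (λ a s → a ∨ (length L ≤ᵇ s)) (sym G y x) (+-comm (count (adj G y) L) _)

nonempty : ∀ {L : List X} {w ws} → 2 ≤ length L → w ∷ ws ↭ L → ws ≢ []
nonempty l2 σ refl with s≤s () ← subst (2 ≤_) (≡-sym (Perm.↭-length σ)) l2

find-gap : ∀ (G : SimpleGraph n) {L w ws} → 2 ≤ length L → w ∷ ws ↭ L → 0 < gaps G (pairs w ws w) →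
  ∃ λ p → ∃₂ λ q es → (p ∷ q ∷ es ↭ L) × adj G p q ≡ false × (pairs p (q ∷ es) p ↭ pairs w ws w)
find-gap G {w = w} {ws} l2 σ pos with (p , q) , e∈ , ne ← count-∃ (not ∘ edge G) (pairs w ws w) pos
  with es , τ , ρ ← rotate-to-pair ws (nonempty l2 σ) e∈ =
  p , q , es , ↭-trans τ σ , trans (≡-sym (not-involutive _)) (cong not ne) , ρ

1<⟦⟧+⟦⟧ : ∀ a b → 1 < ⟦ a ⟧ + ⟦ b ⟧ → a ≡ true × b ≡ true
1<⟦⟧+⟦⟧ true  true  _ = refl , refl
1<⟦⟧+⟦⟧ true  false (s≤s ())
1<⟦⟧+⟦⟧ false true  (s≤s ())

-- There is one pair fewer than there are vertices, so a degree sum of `length L` counts some pair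
-- twice.
crossing : ∀ (G : SimpleGraph n) {L p q es} → p ∷ q ∷ es ↭ L →
  length L ≤ count (adj G p) L + count (adj G q) L →
  ∃₂ λ c d → (c , d) ∈ pairs q es p × adj G p c ≡ true × adj G q d ≡ true
crossing G {L} {p} {q} {es} σ large =
  let (c , d) , cd∈ , lt = pigeonhole (adj G p ∘ proj₁) (adj G q ∘ proj₂) (const true) (pairs q es p) many
  in c , d , cd∈ , 1<⟦⟧+⟦⟧ _ _ lt
  where
  open ≤-Reasoning
  many : count (const true) (pairs q es p)
    < count (adj G p ∘ proj₁) (pairs q es p) + count (adj G q ∘ proj₂) (pairs q es p)
  many = begin-strict
    count (const true) (pairs q es p)       ≡⟨ count-true (pairs q es p) ⟩
    length (pairs q es p)                   ≡⟨ length-pairs q es ⟩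
    length (q ∷ es)                         <⟨ ≤-reflexive (Perm.↭-length σ) ⟩
    length L                                ≤⟨ large ⟩
    count (adj G p) L + count (adj G q) L   ≡⟨ end-degrees G σ ⟩
    _                                       ∎

eligible-gap : ∀ (G : SimpleGraph n) {L p q} → adj G p q ≡ false → Eligible G L (p , q) ≡ true →
  length L ≤ count (adj G p) L + count (adj G q) L
eligible-gap G pq el rewrite pq = ≤ᵇ⇒≤ _ _ (Equivalence.from T-≡ el)

eligible-edge : ∀ (G : SimpleGraph n) {L x y} → adj G x y ≡ true → Eligible G L (x , y) ≡ true
eligible-edge G xy rewrite xy = refl

-- Bondy–Chvátal: a gap (p , q) with large degree sum admits a 2-opt move creating two edges.
close : ∀ (G : SimpleGraph n) {L} → 2 ≤ length L → ∀ g {w ws} → w ∷ ws ↭ L →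
  count (not ∘ Eligible G L) (pairs w ws w) ≡ 0 → gaps G (pairs w ws w) ≤ g → Cycle G L
close G l2 zero    σ el le = _ , _ , σ , count-not-zero (edge G) _ (n≤0⇒n≡0 le)
close G {L} l2 (suc g) {w} {ws} σ el le with gaps G (pairs w ws w) in geq
... | zero   = w , ws , σ , count-not-zero (edge G) _ geq
... | suc g′
  with p , q , es , τ , pq , ρ ← find-gap G l2 σ (≤-trans (s≤s z≤n) (≤-reflexive (≡-sym geq)))
  with c , d , cd∈ , pc , qd ← crossing G τ (eligible-gap G {L} pq (All.lookup (count-not-zero (Eligible G L) _ el) (Perm.∈-resp-↭ ρ (here refl))))
  with w′ , ws′ , υ , balance ← two-opt es cd∈ =
  close G l2 g (↭-trans υ τ) el′ le′
  where
  -- The two pairs created are edges, hence eligible, so no ineligible pair appears.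
  el′ : count (not ∘ Eligible G L) (pairs w′ ws′ w′) ≡ 0
  el′ = m+n≡0⇒m≡0 _ (begin
    count (not ∘ Eligible G L) (pairs w′ ws′ w′) + _
      ≡⟨ balance (not ∘ Eligible G L) (cong not ∘ eligible-sym G L) ⟩
    count (not ∘ Eligible G L) (pairs p (q ∷ es) p) + (⟦ not (Eligible G L (p , c)) ⟧ + ⟦ not (Eligible G L (q , d)) ⟧)
      ≡⟨ cong₂ _+_ (trans (count-↭ _ ρ) el) (cong₂ (λ a b → ⟦ not a ⟧ + ⟦ not b ⟧) (eligible-edge G {L} pc) (eligible-edge G {L} qd)) ⟩
    0 ∎)
    where open ≡-Reasoning
  -- The gap `(p , q)` disappears and no new one arises, so the bound `g` can decrease.
  le′ : gaps G (pairs w′ ws′ w′) ≤ g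
  le′ = ≤-trans (≤-pred (begin
    suc (gaps G (pairs w′ ws′ w′))   ≡⟨ +-comm 1 _ ⟩
    gaps G (pairs w′ ws′ w′) + 1     ≤⟨ +-monoʳ-≤ _ (m≤m+n 1 _) ⟩
    gaps G (pairs w′ ws′ w′) + (1 + ⟦ not (edge G (c , d)) ⟧)
      ≡⟨ cong (λ b → gaps G (pairs w′ ws′ w′) + (⟦ not b ⟧ + ⟦ not (edge G (c , d)) ⟧)) pq ⟨
    gaps G (pairs w′ ws′ w′) + (⟦ not (adj G p q) ⟧ + ⟦ not (edge G (c , d)) ⟧)
      ≡⟨ balance (not ∘ edge G) (gap-sym G) ⟩
    gaps G (pairs p (q ∷ es) p) + (⟦ not (adj G p c) ⟧ + ⟦ not (adj G q d) ⟧)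
      ≡⟨ cong₂ _+_ (count-↭ _ ρ) (cong₂ (λ a b → ⟦ not a ⟧ + ⟦ not b ⟧) pc qd) ⟩
    gaps G (pairs w ws w) + 0        ≡⟨ trans (+-identityʳ _) geq ⟩
    suc g′                           ∎)) (≤-pred le)
    where open ≤-Reasoning

eligible : ∀ (G : SimpleGraph n) {L x y} → length L ≤ count (adj G x) L + count (adj G y) L → Eligible G L (x , y) ≡ true
eligible G {L} {x} {y} le with adj G x y
... | true  = refl
... | false = Equivalence.to T-≡ (≤⇒≤ᵇ le)

pairs-∈₁ : ∀ {u : X} ds {v c d} → (c , d) ∈ pairs u ds v → c ∈ u ∷ ds
pairs-∈₁ ds m = subst (_ ∈_) (pairs-proj₁ _ ds) (∈-map⁺ proj₁ m)

pairs-∈₂ : ∀ {u : X} ds {v c d} → (c , d) ∈ pairs u ds v → d ∈ ds ∷ʳ v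
pairs-∈₂ ds m = subst (_ ∈_) (pairs-proj₂ _ ds) (∈-map⁺ proj₂ m)

-- Every two vertices are eligible, so `close` can start from the given order of `L`.
dirac : ∀ (G : SimpleGraph n) L t → 2 ≤ length L → length L ≤ t + t →
  (∀ {x} → x ∈ L → t ≤ count (adj G x) L) → Cycle G L
dirac G []       t () _ _
dirac G (w ∷ ws) t l2 le deg = close G l2 _ ↭-refl
  (all⇒count-not (Eligible G (w ∷ ws)) (All.tabulate λ m → eligible G {w ∷ ws}
    (≤-trans le (+-mono-≤ (deg (pairs-∈₁ ws m)) (deg (Perm.∈-resp-↭ (↭-sym (Perm.∷↭∷ʳ w ws)) (pairs-∈₂ ws m)))))))
  ≤-refl

-- A 2-opt-minimal arrangement: the moves at the gap (p , q) create at most as many edges as they destroy.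
minimal-gap : ∀ (G : SimpleGraph n) {L} → 2 ≤ length L → ∀ g {w ws} → w ∷ ws ↭ L → gaps G (pairs w ws w) ≤ g →
  Cycle G L ⊎ ∃ λ p → ∃₂ λ q es → (p ∷ q ∷ es ↭ L) × adj G p q ≡ false ×
    count (adj G p) L + count (adj G q) L + gaps G (pairs q es p) ≤ suc (length es)
minimal-gap G l2 zero    σ le = inj₁ (_ , _ , σ , count-not-zero (edge G) _ (n≤0⇒n≡0 le))
minimal-gap G {L} l2 (suc g) {w} {ws} σ le with gaps G (pairs w ws w) in geq
... | zero   = inj₁ (w , ws , σ , count-not-zero (edge G) _ geq)
... | suc g′
  with p , q , es , τ , pq , ρ ← find-gap G l2 σ (≤-trans (s≤s z≤n) (≤-reflexive (≡-sym geq)))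
  -- Both counts run over the possible moves. If the adjacencies to `p` and `q` outnumber the edges
  -- in total, some single move creates more edges than it destroys from the path.
  with count (edge G) (pairs q es p) <? count (adj G p ∘ proj₁) (pairs q es p) + count (adj G q ∘ proj₂) (pairs q es p)
... | no ¬lt = inj₂ (p , q , es , τ , pq , (begin
    count (adj G p) L + count (adj G q) L + gaps G (pairs q es p)  ≡⟨ cong (_+ gaps G (pairs q es p)) (end-degrees G τ) ⟩
    _ + gaps G (pairs q es p)                                      ≤⟨ +-monoˡ-≤ _ (≮⇒≥ ¬lt) ⟩
    count (edge G) (pairs q es p) + gaps G (pairs q es p)          ≡⟨ count-not (edge G) (pairs q es p) ⟩
    length (pairs q es p)                                          ≡⟨ length-pairs q es ⟩
    suc (length es)                                                ∎))
    where open ≤-Reasoning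
... | yes lt
  with (c , d) , cd∈ , gain ← pigeonhole (adj G p ∘ proj₁) (adj G q ∘ proj₂) (edge G) (pairs q es p) lt
  with w′ , ws′ , υ , balance ← two-opt es cd∈ =
  minimal-gap G l2 g (↭-trans υ τ) (≤-trans (≤-pred (+-cancelʳ-≤ (x + y) _ _ (begin
    suc (gaps G (pairs w′ ws′ w′)) + (x + y)      ≡⟨ +-suc _ (x + y) ⟨
    gaps G (pairs w′ ws′ w′) + suc (x + y)        ≤⟨ +-monoʳ-≤ _ (complement (adj G p c) (adj G q d) (adj G c d) gain) ⟩
    gaps G (pairs w′ ws′ w′) + (1 + z)            ≡⟨ cong (λ b → gaps G (pairs w′ ws′ w′) + (⟦ not b ⟧ + z)) pq ⟨
    gaps G (pairs w′ ws′ w′) + (⟦ not (adj G p q) ⟧ + z)   ≡⟨ balance (not ∘ edge G) (gap-sym G) ⟩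
    gaps G (pairs p (q ∷ es) p) + (x + y)         ≡⟨ cong (_+ (x + y)) (trans (count-↭ _ ρ) geq) ⟩
    suc g′ + (x + y)                              ∎))) (≤-pred le))
  where
  open ≤-Reasoning
  x = ⟦ not (adj G p c) ⟧
  y = ⟦ not (adj G q d) ⟧
  z = ⟦ not (adj G c d) ⟧
  complement : ∀ a b c → ⟦ c ⟧ < ⟦ a ⟧ + ⟦ b ⟧ → ⟦ not a ⟧ + ⟦ not b ⟧ < 1 + ⟦ not c ⟧
  complement true  true  _     _ = s≤s z≤n
  complement true  false false _ = s≤s (s≤s z≤n)
  complement false true  false _ = s≤s (s≤s z≤n)
  complement true  false true  (s≤s ())
  complement false true  true  (s≤s ())

-- Both p ~ c and q ~ d would close a cycle by a 2-opt move, and the degree sum leaves no room for neither.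
exact : ∀ (G : SimpleGraph n) {L p q es} → ¬ Cycle G L → p ∷ q ∷ es ↭ L → Path G q es p →
  suc (length es) ≤ count (adj G p) L + count (adj G q) L →
  ∀ {c d} → (c , d) ∈ pairs q es p → adj G p c ≡ not (adj G q d)
exact G {L} {p} {q} {es} ¬cyc σ path large {c} {d} m = agree (adj G p c) (adj G q d) (one m) (rigid m)
  where
  agree : ∀ a b → (a ≡ true → not b ≡ true) → (not b ≡ true → a ≡ true) → a ≡ not b
  agree true  b h _ = ≡-sym (h refl)
  agree false true  _ _ = refl
  agree false false _ h = h refl
  one : ∀ {e} → e ∈ pairs q es p → adj G p (proj₁ e) ≡ true → not (adj G q (proj₂ e)) ≡ true
  one {c , d} m pc with adj G q d in qd
  ... | false = refl
  ... | true with w , ws , τ , balance ← two-opt es m =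
    -- Whether `p` and `q` are adjacent is left open: their indicator stands on both sides and
    -- cancels.
    contradiction (w , ws , ↭-trans τ σ , count-not-zero (edge G) _ (+-cancelʳ-≡ (⟦ not (adj G p q) ⟧ + 0) _ _ (begin
      gaps G (pairs w ws w) + (⟦ not (adj G p q) ⟧ + 0)
        ≡⟨ cong (λ b → gaps G (pairs w ws w) + (⟦ not (adj G p q) ⟧ + ⟦ not b ⟧)) (All.lookup path m) ⟨
      gaps G (pairs w ws w) + (⟦ not (adj G p q) ⟧ + ⟦ not (adj G c d) ⟧)
        ≡⟨ balance (not ∘ edge G) (gap-sym G) ⟩
      ⟦ not (adj G p q) ⟧ + gaps G (pairs q es p) + (⟦ not (adj G p c) ⟧ + ⟦ not (adj G q d) ⟧)
        ≡⟨ cong₂ (λ s t → ⟦ not (adj G p q) ⟧ + s + t) (all⇒count-not (edge G) path) (cong₂ (λ a b → ⟦ not a ⟧ + ⟦ not b ⟧) pc qd) ⟩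
      ⟦ not (adj G p q) ⟧ + 0 + 0   ≡⟨ +-identityʳ _ ⟩
      ⟦ not (adj G p q) ⟧ + 0       ∎))) ¬cyc
      where open ≡-Reasoning
  rigid : ∀ {e} → e ∈ pairs q es p → not (adj G q (proj₂ e)) ≡ true → adj G p (proj₁ e) ≡ true
  rigid = count-rigid (pairs q es p) one (+-cancelʳ-≤ (count (adj G q ∘ proj₂) (pairs q es p)) _ _ (begin
    count (not ∘ adj G q ∘ proj₂) (pairs q es p) + count (adj G q ∘ proj₂) (pairs q es p)
      ≡⟨ +-comm (count (not ∘ adj G q ∘ proj₂) (pairs q es p)) _ ⟩
    count (adj G q ∘ proj₂) (pairs q es p) + count (not ∘ adj G q ∘ proj₂) (pairs q es p)
      ≡⟨ count-not (adj G q ∘ proj₂) (pairs q es p) ⟩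
    length (pairs q es p)      ≡⟨ length-pairs q es ⟩
    suc (length es)            ≤⟨ large ⟩
    count (adj G p) L + count (adj G q) L   ≡⟨ end-degrees G σ ⟩
    _ ∎))
    where open ≤-Reasoning

-- The closure as a sequence of graphs

∧-true : ∀ a {b} → a ∧ b ≡ true → a ≡ true × b ≡ true
∧-true true eq = refl , eq

-- One round of the Bondy–Chvátal closure.
stage : SimpleGraph n → SimpleGraph n
stage {n} G = record
  -- The degree condition may hold for `i` paired with itself, so the diagonal is removed.
  { adj   = λ i j → Eligible G (allFin n) (i , j) ∧ not (does (i ≟ᶠ j))
  ; sym   = λ i j → cong₂ _∧_ (eligible-sym G (allFin n) (j , i)) (cong not (≟-sym i j))
  ; irref = λ i → trans (cong (λ b → Eligible G (allFin n) (i , i) ∧ not b) (dec-true (i ≟ᶠ i) refl)) (∧-zeroʳ _)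
  }
  where
  ≟-sym : ∀ (i j : Fin n) → does (i ≟ᶠ j) ≡ does (j ≟ᶠ i)
  ≟-sym i j with i ≟ᶠ j
  ... | yes refl = ≡-sym (dec-true (i ≟ᶠ i) refl)
  ... | no i≢j   = ≡-sym (dec-false (j ≟ᶠ i) (i≢j ∘ ≡-sym))

adjacent⇒≢ : ∀ (G : SimpleGraph n) {i j} → adj G i j ≡ true → i ≢ j
adjacent⇒≢ G {i} ij refl = true≢false ij (irref G i)

eligible⇒stage : ∀ (G : SimpleGraph n) {i j} → i ≢ j → Eligible G (allFin n) (i , j) ≡ true → adj (stage G) i j ≡ true
eligible⇒stage G {i} {j} i≢j el = cong₂ (λ a b → a ∧ not b) el (dec-false (i ≟ᶠ j) i≢j)

stage-⊇ : ∀ (G : SimpleGraph n) {i j} → adj G i j ≡ true → adj (stage G) i j ≡ true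
stage-⊇ {n} G ij = eligible⇒stage G (adjacent⇒≢ G ij) (eligible-edge G {allFin n} ij)

stage-ore : ∀ (G : SimpleGraph n) {i j} → i ≢ j → n ≤ degree G i + degree G j → adj (stage G) i j ≡ true
stage-ore {n} G i≢j le = eligible⇒stage G i≢j
  (eligible G {allFin n} (≤-trans (≤-reflexive (length-tabulate {n = n} (λ i → i))) le))

-- Edges of `stage G` are eligible pairs of `G`, so a cycle of the stage is a valid start for
-- `close`.
stage-cycle : ∀ (G : SimpleGraph n) → 2 ≤ n → Cycle (stage G) (allFin n) → Cycle G (allFin n)
stage-cycle {n} G 2≤n (w , ws , σ , path) =
  close G (subst (2 ≤_) (≡-sym (length-tabulate {n = n} (λ i → i))) 2≤n) _ σ
    (all⇒count-not (Eligible G (allFin n)) (All.map (proj₁ ∘ ∧-true _) path)) ≤-refl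

-- Deciding whether a cycle exists

split-search : ∀ (zs : List X) {R : List X → List X → Set} → (∀ as bs → Dec (R as bs)) →
  Dec (∃₂ λ as bs → zs ≡ as ++ bs × R as bs)
split-search []       R? = map′ (λ r → [] , [] , refl , r) (λ { ([] , [] , refl , r) → r }) (R? [] [])
split-search (z ∷ zs) R? = map′
  (λ { (inj₁ r) → [] , z ∷ zs , refl , r
     ; (inj₂ (as , bs , eq , r)) → z ∷ as , bs , cong (z ∷_) eq , r })
  (λ { ([] , _ , refl , r) → inj₁ r
     ; (_ ∷ as , bs , refl , r) → inj₂ (as , bs , refl , r) })
  (R? [] (z ∷ zs) ⊎-dec split-search zs (λ as → R? (z ∷ as)))

-- A permutation of `x ∷ xs` is a permutation of `xs` with `x` inserted at one of finitely many
-- places.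
permutation-search : ∀ (xs : List X) {P : List X → Set} → (∀ ys → Dec (P ys)) → Dec (∃ λ ys → ys ↭ xs × P ys)
permutation-search [] {P} P? = map′ (λ p → [] , ↭-refl , p)
  (λ { (ys , σ , p) → subst P (Perm.↭-empty-inv σ) p }) (P? [])
permutation-search (x ∷ xs) {P} P? = map′ insert delete
  (permutation-search xs (λ zs → split-search zs (λ as bs → P? (as ++ x ∷ bs))))
  where
  insert : _ → ∃ λ ys → ys ↭ x ∷ xs × P ys
  insert (zs , σ , as , bs , refl , p) = as ++ x ∷ bs , ↭-trans (Perm.shift x as bs) (↭-prep x σ) , p
  delete : (∃ λ ys → ys ↭ x ∷ xs × P ys) → ∃ λ zs → zs ↭ xs × ∃₂ λ as bs → zs ≡ as ++ bs × P (as ++ x ∷ bs)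
  delete (ys , σ , p) with as , bs , refl ← ∈-∃++ (Perm.∈-resp-↭ (↭-sym σ) (here refl)) =
    as ++ bs , Perm.drop-∷ (↭-trans (↭-sym (Perm.shift x as bs)) σ) , as , bs , refl , p

-- The main argument starts from the absence of a cycle; this search makes the case distinction
-- constructive.
cycle? : ∀ (G : SimpleGraph n) L → Dec (Cycle G L)
cycle? {n} G L = map′
  (λ { ([] , _ , ()) ; (w ∷ ws , σ , path) → w , ws , σ , path })
  (λ { (w , ws , σ , path) → w ∷ ws , σ , path })
  (permutation-search L closed?)
  where
  Closed : List (Fin n) → Set
  Closed []       = ⊥
  Closed (w ∷ ws) = Path G w ws w
  closed? : ∀ ys → Dec (Closed ys)
  closed? []       = no λ ()
  closed? (w ∷ ws) = All.all? (λ e → edge G e ≟ true) (pairs w ws w)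

-- From cyclic lists to permutations of the vertices

pairs-lookup : ∀ (u : X) ds {v} (i j : Fin (length (u ∷ ds))) → toℕ j ≡ suc (toℕ i) →
  (lookup (u ∷ ds) i , lookup (u ∷ ds) j) ∈ pairs u ds v
pairs-lookup u (d ∷ ds) fzero    (fsuc fzero) eq = here refl
pairs-lookup u (d ∷ ds) (fsuc i) (fsuc j)     eq = there (pairs-lookup d ds i j (suc-injective eq))

pairs-last : ∀ (u : X) ds {v} (i : Fin (length (u ∷ ds))) → toℕ i ≡ length ds → (lookup (u ∷ ds) i , v) ∈ pairs u ds v
pairs-last u []       fzero    eq = here refl
pairs-last u (d ∷ ds) (fsuc i) eq = there (pairs-last d ds i (suc-injective eq))

lookup-zero : ∀ (u : X) ds (j : Fin (length (u ∷ ds))) → toℕ j ≡ 0 → lookup (u ∷ ds) j ≡ u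
lookup-zero u ds fzero eq = refl

-- The list `w ∷ ws` rearranges `allFin n`, and the bijection of indices behind this rearrangement
-- is the permutation sought; the casts only identify lengths with `n`.
cycle⇒hamiltonian : ∀ (G : SimpleGraph n) → 3 ≤ n → Cycle G (allFin n) → Hamiltonian G
cycle⇒hamiltonian {n} G 3≤n (w , ws , τ , path) = 3≤n , σ , consecutive , closing
  where
  len : length (allFin n) ≡ n
  len = length-tabulate (λ i → i)
  len-w : n ≡ length (w ∷ ws)
  len-w = ≡-sym (trans (Perm.↭-length τ) len)
  σ : Permutation′ n
  σ = cast-id len-w ∘ₚ (onIndices (↭⇒↭ₛ τ) ∘ₚ cast-id len)
  σ-lookup : ∀ i → lookup (w ∷ ws) (cast len-w i) ≡ σ ⟨$⟩ʳ i
  σ-lookup i = begin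
    lookup (w ∷ ws) (cast len-w i)                     ≡⟨ onIndices-lookup (≡-setoid (Fin n)) (↭⇒↭ₛ τ) (cast len-w i) ⟩
    lookup (allFin n) j                                ≡⟨ cong (lookup (allFin n)) (cast-involutive (≡-sym len) len j) ⟨
    lookup (allFin n) (cast (≡-sym len) (cast len j))  ≡⟨ lookup-tabulate (λ i → i) (cast len j) ⟩
    cast len j                                         ∎
    where
    open ≡-Reasoning
    j = onIndices (↭⇒↭ₛ τ) ⟨$⟩ʳ cast len-w i
  consecutive : ∀ i j → toℕ j ≡ suc (toℕ i) → adj G (σ ⟨$⟩ʳ i) (σ ⟨$⟩ʳ j) ≡ true
  consecutive i j eq = subst (λ e → edge G e ≡ true) (cong₂ _,_ (σ-lookup i) (σ-lookup j))
    (All.lookup path (pairs-lookup w ws (cast len-w i) (cast len-w j)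
      (trans (toℕ-cast len-w j) (trans eq (cong suc (≡-sym (toℕ-cast len-w i)))))))
  closing : ∀ i j → toℕ i ≡ n ∸ 1 → toℕ j ≡ 0 → adj G (σ ⟨$⟩ʳ i) (σ ⟨$⟩ʳ j) ≡ true
  closing i j i≡ j≡ = subst (λ e → edge G e ≡ true)
    (cong₂ _,_ (σ-lookup i) (trans (≡-sym (lookup-zero w ws _ (trans (toℕ-cast len-w j) j≡))) (σ-lookup j)))
    (All.lookup path (pairs-last w ws (cast len-w i) (trans (toℕ-cast len-w i) (trans i≡ (cong (_∸ 1) len-w)))))

-- Applied to adjacency to `q` along a path, this separates a cycle missing one vertex from
-- neighbours forming an initial segment.
scan : ∀ (f : X → Bool) xs →
  (∃₂ λ as c → ∃₂ λ d bs → xs ≡ as ++ c ∷ d ∷ bs × f c ≡ false × f d ≡ true) ⊎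
  (∃₂ λ as bs → xs ≡ as ++ bs × All (λ x → f x ≡ true) as × All (λ x → f x ≡ false) bs)
scan f [] = inj₂ ([] , [] , refl , [] , [])
scan f (x ∷ xs) with scan f xs
... | inj₁ (as , c , d , bs , refl , fc , fd) = inj₁ (x ∷ as , c , d , bs , refl , fc , fd)
... | inj₂ (as , bs , refl , as-true , bs-false) with f x in fx
...   | true  = inj₂ (x ∷ as , bs , refl , fx ∷ as-true , bs-false)
...   | false with as | as-true
...     | []      | []     = inj₂ ([] , x ∷ bs , refl , [] , fx ∷ bs-false)
...     | d ∷ as′ | fd ∷ _ = inj₁ ([] , x , d , as′ ++ bs , refl , fx , fd)

1≢m+m : ∀ m → 1 ≢ m + m
1≢m+m (suc m) eq with () ← trans (suc-injective eq) (+-suc m m)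

-- Graphs on 2k + 1 vertices of minimum degree k

module Tight (k : ℕ) (G : SimpleGraph (suc (k + k))) (1≤k : 1 ≤ k)
  (min-degree : ∀ i → k ≤ degree G i)
  (few : count (λ i → k <ᵇ degree G i) (allFin (suc (k + k))) < k)
  (¬cycle : ¬ Cycle G (allFin (suc (k + k)))) where

  V : List (Fin (suc (k + k)))
  V = allFin (suc (k + k))

  length-V : ∀ {zs} → zs ↭ V → length zs ≡ suc (k + k)
  length-V σ = trans (Perm.↭-length σ) (length-tabulate {n = suc (k + k)} (λ i → i))

  exact-path : ∀ {p q es} → p ∷ q ∷ es ↭ V → Path G q es p →
    ∀ {c d} → (c , d) ∈ pairs q es p → adj G p c ≡ not (adj G q d)
  exact-path {p} {q} σ path = exact G ¬cycle σ path
    (≤-trans (≤-reflexive (suc-injective (length-V σ))) (+-mono-≤ (min-degree p) (min-degree q)))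

  -- The successors of the neighbours of x, together with x, are independent, and each of them is
  -- adjacent to all the k remaining vertices, which thus have degree above k.
  module Missing {x w ws} (σ : x ∷ w ∷ ws ↭ V) (path : Path G w ws w) where

    P = pairs w ws w

    ws≢[] : ws ≢ []
    ws≢[] refl = 1≢m+m k (suc-injective (length-V σ))

    -- Opening the cycle between `c` and `d` and appending `x` after `c` gives a Hamiltonian path
    -- from `d` to `x`. Exactness at its last pair `(c , x)` gives the first claim, at the other
    -- pairs the second.
    rotated : ∀ {c d} → (c , d) ∈ P → adj G x c ≡ true →
      adj G d x ≡ false × (∀ {b t} → (b , t) ∈ P → adj G x b ≡ false → adj G d t ≡ true)
    rotated {c} {d} cd∈ xc with es , τ , ρ ← rotate-to-pair ws ws≢[] cd∈ = nonadj , other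
      where
      path′ : Path G d (es ∷ʳ c) x
      path′ = path-++ G d es [] (All.tail (Perm.All-resp-↭ (↭-sym ρ) path)) (trans (sym G c x) xc ∷ [])
      ex : ∀ {a b} → (a , b) ∈ pairs d (es ∷ʳ c) x → adj G x a ≡ not (adj G d b)
      ex = exact-path (↭-trans (↭-prep x (↭-trans (↭-sym (Perm.∷↭∷ʳ c (d ∷ es))) τ)) σ) path′
      nonadj : adj G d x ≡ false
      nonadj = trans (≡-sym (not-involutive _)) (cong not (trans (≡-sym (ex
        (subst ((c , x) ∈_) (≡-sym (pairs-++ d es [])) (∈-++⁺ʳ (pairs d es c) (here refl))))) xc))
      other : ∀ {b t} → (b , t) ∈ P → adj G x b ≡ false → adj G d t ≡ true
      other bt∈ xb with Perm.∈-resp-↭ (↭-sym ρ) bt∈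
      ... | here refl = ⊥-elim (true≢false xc xb)
      ... | there bt∈′ = trans (≡-sym (not-involutive _)) (cong not (trans (≡-sym (ex
        (subst (_ ∈_) (≡-sym (pairs-++ d es [])) (∈-++⁺ˡ bt∈′)))) xb))

    degree-split : ∀ t → degree G t ≡ ⟦ adj G t x ⟧ + count (adj G t) (w ∷ ws)
    degree-split t = count-↭ (adj G t) (↭-sym σ)

    degree-x : degree G x ≡ count (adj G x ∘ proj₁) P
    degree-x = trans (degree-split x)
      (trans (cong (λ b → ⟦ b ⟧ + count (adj G x) (w ∷ ws)) (irref G x)) (≡-sym (count-cycle₁ (adj G x) w ws)))

    length-P : length P ≡ k + k
    length-P = trans (length-pairs w ws) (suc-injective (length-V σ))

    successor : ∀ {e} → e ∈ P → adj G x (proj₁ e) ≡ true → not (adj G x (proj₂ e)) ≡ true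
    successor {c , d} cd∈ xc = cong not (trans (sym G x d) (proj₁ (rotated cd∈ xc)))

    complement₂ : count (not ∘ adj G x ∘ proj₂) P + degree G x ≡ k + k
    complement₂ = begin
      count (not ∘ adj G x ∘ proj₂) P + degree G x                     ≡⟨ +-comm _ (degree G x) ⟩
      degree G x + count (not ∘ adj G x ∘ proj₂) P                     ≡⟨ cong (_+ count (not ∘ adj G x ∘ proj₂) P)
        (trans degree-x (trans (count-cycle₁ (adj G x) w ws) (≡-sym (count-cycle₂ (adj G x) w ws)))) ⟩
      count (adj G x ∘ proj₂) P + count (not ∘ adj G x ∘ proj₂) P      ≡⟨ count-not (adj G x ∘ proj₂) P ⟩
      length P                                                         ≡⟨ length-P ⟩
      k + k                                                            ∎
      where open ≡-Reasoning

    complement₁ : degree G x + count (not ∘ adj G x ∘ proj₁) P ≡ k + k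
    complement₁ = trans (cong (_+ count (not ∘ adj G x ∘ proj₁) P) degree-x)
      (trans (count-not (adj G x ∘ proj₁) P) length-P)

    complement₂≤k : count (not ∘ adj G x ∘ proj₂) P ≤ k
    complement₂≤k = +-cancelʳ-≤ k _ _ (≤-trans (+-monoʳ-≤ _ (min-degree x)) (≤-reflexive complement₂))

    degree-x≤k : degree G x ≤ k
    degree-x≤k = ≤-trans (≤-reflexive degree-x) (≤-trans (count-mono P successor) complement₂≤k)

    -- The successors of the neighbours of `x` are at least k non-neighbours, and at most k
    -- non-neighbours lie on the cycle. Hence every non-neighbour there follows a neighbour.
    non-neighbour : ∀ {b t} → (b , t) ∈ P → adj G x b ≡ false → adj G x t ≡ true
    non-neighbour {b} {t} bt∈ xb with adj G x t in xt
    ... | true  = refl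
    ... | false = ⊥-elim (true≢false (count-rigid P successor
      (≤-trans complement₂≤k (≤-trans (min-degree x) (≤-reflexive degree-x))) bt∈ (cong not xt)) xb)

    -- Besides `x`, the vertex `t` is adjacent to the successors of all neighbours of `x`, of which
    -- there are at least k.
    high : ∀ {e} → e ∈ P → not (adj G x (proj₁ e)) ≡ true → (k <ᵇ degree G (proj₂ e)) ≡ true
    high {b , t} bt∈ ¬xb = Equivalence.to T-≡ (<⇒<ᵇ (begin-strict
      k                                            ≤⟨ min-degree x ⟩
      degree G x                                   ≡⟨ degree-x ⟩
      count (adj G x ∘ proj₁) P                    ≤⟨ count-mono P (λ { {c , d} cd∈ xc → trans (sym G t d) (proj₂ (rotated cd∈ xc) bt∈ xb) }) ⟩
      count (adj G t ∘ proj₂) P                    <⟨ n<1+n _ ⟩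
      1 + count (adj G t ∘ proj₂) P                ≡⟨ cong₂ (λ a c → ⟦ a ⟧ + c) (≡-sym (trans (sym G t x) (non-neighbour bt∈ xb))) (count-cycle₂ (adj G t) w ws) ⟩
      ⟦ adj G t x ⟧ + count (adj G t) (w ∷ ws)     ≡⟨ degree-split t ⟨
      degree G t                                   ∎))
      where
      open ≤-Reasoning
      xb : adj G x b ≡ false
      xb = trans (≡-sym (not-involutive _)) (cong not ¬xb)

    impossible : ⊥
    impossible = <-irrefl refl (begin-strict
      count (λ i → k <ᵇ degree G i) V                     <⟨ few ⟩
      k                                                   ≤⟨ +-cancelˡ-≤ k _ _ (≤-trans (≤-reflexive (≡-sym complement₁)) (+-monoˡ-≤ _ degree-x≤k)) ⟩
      count (not ∘ adj G x ∘ proj₁) P                     ≤⟨ count-mono P high ⟩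
      count ((λ i → k <ᵇ degree G i) ∘ proj₂) P           ≡⟨ count-cycle₂ (λ i → k <ᵇ degree G i) w ws ⟩
      count (λ i → k <ᵇ degree G i) (w ∷ ws)              ≤⟨ m≤n+m _ ⟦ k <ᵇ degree G x ⟧ ⟩
      count (λ i → k <ᵇ degree G i) (x ∷ w ∷ ws)          ≡⟨ count-↭ (λ i → k <ᵇ degree G i) σ ⟩
      count (λ i → k <ᵇ degree G i) V                     ∎)
      where open ≤-Reasoning

  -- By exactness the predecessor `e` of `c` is adjacent to `p`. Going from `q` to `e`, on to `p`,
  -- back along the path to `d` and then to `q` gives a cycle missing only `c`.
  non-prefix : ∀ {p q} as {c d} bs → p ∷ q ∷ as ++ c ∷ d ∷ bs ↭ V → Path G q (as ++ c ∷ d ∷ bs) p →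
    adj G q c ≡ false → adj G q d ≡ true → ⊥
  non-prefix {p} {q} as bs σ path qc qd with initLast as
  non-prefix {p} {q} .[] bs σ (qc′ ∷ _) qc qd | [] = true≢false qc′ qc
  non-prefix {p} {q} .(as′ ∷ʳ e) {c} {d} bs σ path qc qd | as′ ∷ʳ′ e =
    Missing.impossible (↭-trans perm σ) (path-++ G q (as′ ∷ʳ e) (reverse bs ∷ʳ d)
      (path-++ G q as′ [] (proj₁ (path-split G q as′ [] before)) (trans (sym G e p) pe ∷ []))
      (path-++ G p (reverse bs) [] (reverse-path G d bs (All.tail after)) (trans (sym G d q) qd ∷ [])))
    where
    before = proj₁ (path-split G q (as′ ∷ʳ e) (d ∷ bs) path)
    after  = proj₂ (path-split G q (as′ ∷ʳ e) (d ∷ bs) path)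
    ec∈ : (e , c) ∈ pairs q ((as′ ∷ʳ e) ++ c ∷ d ∷ bs) p
    ec∈ = subst (_ ∈_) (≡-sym (pairs-++ q (as′ ∷ʳ e) (d ∷ bs)))
      (∈-++⁺ˡ (subst (_ ∈_) (≡-sym (pairs-++ q as′ [])) (∈-++⁺ʳ (pairs q as′ e) (here refl))))
    pe : adj G p e ≡ true
    pe = trans (exact-path σ path ec∈) (cong not qc)
    perm : c ∷ q ∷ (as′ ∷ʳ e) ++ p ∷ (reverse bs ∷ʳ d) ↭ p ∷ q ∷ (as′ ∷ʳ e) ++ c ∷ d ∷ bs
    perm = begin
      c ∷ q ∷ (as′ ∷ʳ e) ++ p ∷ (reverse bs ∷ʳ d)   ↭⟨ Perm.shift p (c ∷ q ∷ (as′ ∷ʳ e)) (reverse bs ∷ʳ d) ⟩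
      p ∷ c ∷ q ∷ (as′ ∷ʳ e) ++ (reverse bs ∷ʳ d)   ↭⟨ Perm.++⁺ˡ (p ∷ c ∷ q ∷ (as′ ∷ʳ e)) (↭-trans (↭-sym (Perm.∷↭∷ʳ d (reverse bs))) (↭-prep d (Perm.↭-reverse bs))) ⟩
      p ∷ c ∷ q ∷ (as′ ∷ʳ e) ++ d ∷ bs              ↭⟨ ↭-prep p (Perm.shift c (q ∷ (as′ ∷ʳ e)) (d ∷ bs)) ⟨
      p ∷ q ∷ (as′ ∷ʳ e) ++ c ∷ d ∷ bs              ∎
      where open PermutationReasoning

  -- This configuration turns out to be two disjoint cliques q ∷ as and bs ∷ʳ p of order k, both joined to z.
  module Prefix {p q as z bs} (σ : p ∷ q ∷ as ++ z ∷ bs ↭ V) (path : Path G q (as ++ z ∷ bs) p)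
    (q-as : All (λ x → adj G q x ≡ true) (as ∷ʳ z)) (q-bs : All (λ x → adj G q x ≡ false) (bs ∷ʳ p)) where

    path₁ = proj₁ (path-split G q as bs path)
    path₂ = proj₂ (path-split G q as bs path)

    -- Beyond `z` there is no neighbour of `q`, so exactness joins `p` to `z` and to all of `bs`.
    p-predecessor : ∀ {a y} → (a , y) ∈ pairs z bs p → adj G p a ≡ true
    p-predecessor m = trans
      (exact-path σ path (subst (_ ∈_) (≡-sym (pairs-++ q as bs)) (∈-++⁺ʳ (pairs q as z) m)))
      (cong not (All.lookup q-bs (pairs-∈₂ bs m)))

    -- Reversing the initial segment up to c gives a Hamiltonian path from c to p.
    separated : ∀ {c y} → c ∈ q ∷ as → y ∈ bs ∷ʳ p → adj G c y ≡ false
    separated (here refl) y∈ = All.lookup q-bs y∈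
    separated {c} {y} (there c∈) y∈
      with as₁ , as₂ , refl ← ∈-∃++ c∈
      with (a , _) , ay∈ , refl ← ∈-map⁻ proj₂ (subst (y ∈_) (≡-sym (pairs-proj₂ z bs)) y∈) =
      trans (≡-sym (not-involutive _)) (cong not (trans (≡-sym (exact-path perm path′ ay∈′)) (p-predecessor ay∈)))
      where
      es′ = reverse as₁ ++ q ∷ as₂ ++ z ∷ bs
      split = path-split G q as₁ as₂ path₁
      q-as₂ : All (λ x → adj G q x ≡ true) (as₂ ∷ʳ z)
      q-as₂ = All.tail (Allₚ.++⁻ʳ as₁ (subst (All _) (++-assoc as₁ (c ∷ as₂) [ z ]) q-as))
      -- After the reversal `q` replaces `c` as predecessor of the first vertex of `as₂ ∷ʳ z`, and
      -- `q` is adjacent to that whole segment.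
      path′ : Path G c es′ p
      path′ = path-++ G c (reverse as₁) (as₂ ++ z ∷ bs) (reverse-path G q as₁ (proj₁ split))
        (path-++ G q as₂ bs (replace-start G as₂ q-as₂ (proj₂ split)) path₂)
      perm : p ∷ c ∷ es′ ↭ V
      perm = ↭-trans (↭-prep p (↭-trans (reverse-segment q as₁ c (as₂ ++ z ∷ bs))
        (↭-reflexive (cong (q ∷_) (≡-sym (++-assoc as₁ (c ∷ as₂) (z ∷ bs))))))) σ
      ay∈′ : (a , y) ∈ pairs c es′ p
      ay∈′ = subst (_ ∈_) (≡-sym (pairs-++ c (reverse as₁) (as₂ ++ z ∷ bs)))
        (∈-++⁺ʳ (pairs c (reverse as₁) q) (subst (_ ∈_) (≡-sym (pairs-++ q as₂ bs)) (∈-++⁺ʳ (pairs q as₂ z) ay∈)))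

    split-V : (q ∷ as) ++ z ∷ (bs ∷ʳ p) ↭ V
    split-V = ↭-trans (↭-trans (↭-reflexive (≡-sym (++-assoc (q ∷ as) (z ∷ bs) [ p ])))
      (↭-sym (Perm.∷↭∷ʳ p (q ∷ as ++ z ∷ bs)))) σ

    degree-split : ∀ i → degree G i ≡ count (adj G i) (q ∷ as) + (⟦ adj G i z ⟧ + count (adj G i) (bs ∷ʳ p))
    degree-split i = trans (count-↭ (adj G i) (↭-sym split-V)) (count-++ (adj G i) (q ∷ as) _)

    length-bs : length (bs ∷ʳ p) ≡ suc (length bs)
    length-bs = Perm.↭-length (↭-sym (Perm.∷↭∷ʳ p bs))

    sizes : suc (length as) + suc (length bs) ≡ k + k
    sizes = suc-injective (trans (cong suc (cong suc (≡-sym (length-++ as)))) (length-V σ))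

    degree-left : ∀ {c} → c ∈ q ∷ as → degree G c ≤ length as + ⟦ adj G c z ⟧
    degree-left {c} c∈ = begin
      degree G c   ≡⟨ degree-split c ⟩
      count (adj G c) (q ∷ as) + (⟦ adj G c z ⟧ + count (adj G c) (bs ∷ʳ p))
        ≡⟨ cong (λ s → count (adj G c) (q ∷ as) + (⟦ adj G c z ⟧ + s)) (count-none (adj G c) _ (separated c∈)) ⟩
      count (adj G c) (q ∷ as) + (⟦ adj G c z ⟧ + 0)
        ≤⟨ +-mono-≤ (≤-pred (count-∉ (adj G c) c∈ (irref G c))) (≤-reflexive (+-identityʳ _)) ⟩
      length as + ⟦ adj G c z ⟧   ∎
      where open ≤-Reasoning

    degree-right : ∀ {y} → y ∈ bs ∷ʳ p → degree G y ≤ length bs + ⟦ adj G y z ⟧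
    degree-right {y} y∈ = begin
      degree G y   ≡⟨ degree-split y ⟩
      count (adj G y) (q ∷ as) + (⟦ adj G y z ⟧ + count (adj G y) (bs ∷ʳ p))
        ≡⟨ cong (_+ (⟦ adj G y z ⟧ + count (adj G y) (bs ∷ʳ p))) (count-none (adj G y) _ (λ {c} c∈ → trans (sym G y c) (separated c∈ y∈))) ⟩
      ⟦ adj G y z ⟧ + count (adj G y) (bs ∷ʳ p)
        ≤⟨ +-monoʳ-≤ ⟦ adj G y z ⟧ (≤-pred (≤-trans (count-∉ (adj G y) y∈ (irref G y)) (≤-reflexive length-bs))) ⟩
      ⟦ adj G y z ⟧ + length bs   ≡⟨ +-comm ⟦ adj G y z ⟧ _ ⟩
      length bs + ⟦ adj G y z ⟧   ∎
      where open ≤-Reasoning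

    m+⟦⟧≤1+m : ∀ m b → m + ⟦ b ⟧ ≤ suc m
    m+⟦⟧≤1+m m true  = ≤-reflexive (+-comm m 1)
    m+⟦⟧≤1+m m false = ≤-trans (≤-reflexive (+-identityʳ m)) (n≤1+n m)

    -- Neighbours lie in the vertex's own block or are `z`, so each block has at least k vertices;
    -- together they have 2k, so both have exactly k.
    k≤left : k ≤ suc (length as)
    k≤left = ≤-trans (min-degree q) (≤-trans (degree-left (here refl)) (m+⟦⟧≤1+m _ _))

    k≤right : k ≤ suc (length bs)
    k≤right = ≤-trans (min-degree p) (≤-trans (degree-right (∈-++⁺ʳ bs (here refl))) (m+⟦⟧≤1+m _ _))

    left≤k : suc (length as) ≤ k
    left≤k = +-cancelʳ-≤ k _ _ (≤-trans (+-monoʳ-≤ (suc (length as)) k≤right) (≤-reflexive sizes))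

    right≤k : suc (length bs) ≤ k
    right≤k = +-cancelˡ-≤ k _ _ (≤-trans (+-monoˡ-≤ (suc (length bs)) k≤left) (≤-reflexive sizes))

    -- A block of k vertices offers each member at most k - 1 neighbours, so the minimum degree
    -- forces the edge to `z`.
    full : ∀ m b → suc m ≤ k → k ≤ m + ⟦ b ⟧ → b ≡ true
    full m true  _ _ = refl
    full m false m<k k≤m = contradiction (≤-trans m<k (≤-trans k≤m (≤-reflexive (+-identityʳ m)))) (<-irrefl refl)

    left-z : ∀ {c} → c ∈ q ∷ as → adj G z c ≡ true
    left-z {c} c∈ = trans (sym G z c) (full _ _ left≤k (≤-trans (min-degree c) (degree-left c∈)))

    right-z : ∀ {y} → y ∈ bs ∷ʳ p → adj G z y ≡ true
    right-z {y} y∈ = trans (sym G z y) (full _ _ right≤k (≤-trans (min-degree y) (degree-right y∈)))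

    degree-z : degree G z ≡ k + k
    degree-z = begin
      degree G z                                       ≡⟨ degree-split z ⟩
      count (adj G z) (q ∷ as) + (⟦ adj G z z ⟧ + count (adj G z) (bs ∷ʳ p))
        ≡⟨ cong₂ (λ s t → s + (⟦ adj G z z ⟧ + t)) (count-all (adj G z) (q ∷ as) left-z) (trans (count-all (adj G z) (bs ∷ʳ p) right-z) length-bs) ⟩
      suc (length as) + (⟦ adj G z z ⟧ + suc (length bs))
        ≡⟨ cong (λ b → suc (length as) + (⟦ b ⟧ + suc (length bs))) (irref G z) ⟩
      suc (length as) + suc (length bs)                ≡⟨ sizes ⟩
      k + k                                            ∎
      where open ≡-Reasoning

    others : ∀ i → i ≢ z → degree G i ≤ k
    others i i≢z with ∈-++⁻ (q ∷ as) (Perm.∈-resp-↭ (↭-sym split-V) (∈-allFin i))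
    ... | inj₁ i∈         = ≤-trans (degree-left i∈) (≤-trans (m+⟦⟧≤1+m _ _) left≤k)
    ... | inj₂ (here eq)  = contradiction eq i≢z
    ... | inj₂ (there i∈) = ≤-trans (degree-right i∈) (≤-trans (m+⟦⟧≤1+m _ _) right≤k)

  Exceptional : Set
  Exceptional = ∃ λ z → k + k ≤ degree G z × (∀ i → i ≢ z → degree G i ≤ k)

  from-path : ∀ {p q es} → p ∷ q ∷ es ↭ V → Path G q es p → adj G p q ≡ false → Exceptional
  from-path {p} {q} {es} σ path pq with scan (adj G q) es
  ... | inj₁ (as , c , d , bs , refl , qc , qd) = ⊥-elim (non-prefix as bs σ path qc qd)
  ... | inj₂ (as , bs , refl , q-as , q-bs) with initLast as
  -- With an empty initial segment, either the graph has two vertices, which parity forbids, or `q`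
  -- would not be adjacent to its own successor.
  from-path {p} {q} σ path pq | inj₂ (.[] , [] , refl , q-as , q-bs) | [] =
    ⊥-elim (1≢m+m k (suc-injective (length-V σ)))
  from-path {p} {q} σ (qb ∷ _) pq | inj₂ (.[] , b ∷ bs , refl , q-as , ¬qb ∷ _) | [] = ⊥-elim (true≢false qb ¬qb)
  from-path {p} {q} σ path pq | inj₂ (.(as ∷ʳ z) , bs , refl , q-as , q-bs) | as ∷ʳ′ z =
    z , ≤-reflexive (≡-sym M.degree-z) , M.others
    where
    module M = Prefix (subst (λ l → p ∷ q ∷ l ↭ V) (∷ʳ-++ as z bs) σ) (subst (λ l → Path G q l p) (∷ʳ-++ as z bs) path)
      q-as (Allₚ.++⁺ q-bs (trans (sym G q p) pq ∷ []))

  exceptional : Exceptional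
  exceptional with minimal-gap G (subst (2 ≤_) (≡-sym (length-V ↭-refl)) (s≤s (≤-trans 1≤k (m≤m+n k k)))) _ ↭-refl ≤-refl
  ... | inj₁ cyc = contradiction cyc ¬cycle
  ... | inj₂ (p , q , es , σ , pq , le) = from-path σ (count-not-zero (edge G) _ no-gaps) pq
    where
    -- The two end degrees already sum to 2k, the whole bound of `minimal-gap`.
    no-gaps : gaps G (pairs q es p) ≡ 0
    no-gaps = n≤0⇒n≡0 (+-cancelˡ-≤ (k + k) _ _ (begin
      k + k + gaps G (pairs q es p)                    ≤⟨ +-monoˡ-≤ _ (+-mono-≤ (min-degree p) (min-degree q)) ⟩
      degree G p + degree G q + gaps G (pairs q es p)  ≤⟨ le ⟩
      suc (length es)                                  ≡⟨ suc-injective (length-V σ) ⟩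
      k + k                                            ≡⟨ +-identityʳ (k + k) ⟨
      k + k + 0                                        ∎))
      where open ≤-Reasoning

-- Counting up to a single vertex, and splitting and rotating lists

∨-true : ∀ a {b} → a ∨ b ≡ true → a ≡ true ⊎ b ≡ true
∨-true true  _  = inj₁ refl
∨-true false eq = inj₂ eq

not-true : ∀ {b} → not b ≡ true → b ≡ false
not-true {false} _ = refl

does-true : ∀ {P : Set} (P? : Dec P) → does P? ≡ true → P
does-true (yes p) _ = p

_≡ᶠ_ : Fin n → Fin n → Bool
x ≡ᶠ y = does (x ≟ᶠ y)

≡ᶠ-refl : ∀ (x : Fin n) → (x ≡ᶠ x) ≡ true
≡ᶠ-refl x = dec-true (x ≟ᶠ x) refl

count-single : ∀ (x : Fin n) {xs} → Unique xs → count (_≡ᶠ x) xs ≤ 1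
count-single x []                   = z≤n
count-single x (_∷_ {y} {ys} y∉ ys!) with y ≟ᶠ x
... | no  _    = count-single x ys!
... | yes refl = s≤s (≤-reflexive (count-none (_≡ᶠ y) ys λ {z} z∈ → dec-false (z ≟ᶠ y) (All.lookup y∉ z∈ ∘ ≡-sym)))

count-subset-insert : ∀ {p q : Fin n → Bool} (x : Fin n) →
  (∀ {y} → p y ≡ true → y ≢ x → q y ≡ true) → count p (allFin n) ≤ suc (count q (allFin n))
count-subset-insert {n} {p} {q} x h = begin
  count p (allFin n)                                ≤⟨ count-mono (allFin n) (λ {y} _ → split y) ⟩
  count (λ y → q y ∨ (y ≡ᶠ x)) (allFin n)           ≤⟨ count-∨ q (_≡ᶠ x) (allFin n) ⟩
  count q (allFin n) + count (_≡ᶠ x) (allFin n)     ≤⟨ +-monoʳ-≤ _ (count-single x (allFin⁺ n)) ⟩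
  count q (allFin n) + 1                            ≡⟨ +-comm _ 1 ⟩
  suc (count q (allFin n))                          ∎
  where
  open ≤-Reasoning
  split : ∀ y → p y ≡ true → q y ∨ (y ≡ᶠ x) ≡ true
  split y py with y ≟ᶠ x
  ... | yes _   = ∨-zeroʳ (q y)
  ... | no  y≢x rewrite h py y≢x = refl

count-subset-strict : ∀ {p q : Fin n → Bool} {x : Fin n} → p x ≡ false → q x ≡ true →
  (∀ {y} → p y ≡ true → q y ≡ true) → suc (count p (allFin n)) ≤ count q (allFin n)
count-subset-strict {n} {p} {q} {x} ¬px qx h = begin
  suc (count p (allFin n))                          ≡⟨ +-comm 1 _ ⟩
  count p (allFin n) + 1                            ≤⟨ +-monoʳ-≤ _ (count-∈ (_≡ᶠ x) (∈-allFin x) (≡ᶠ-refl x)) ⟩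
  count p (allFin n) + count (_≡ᶠ x) (allFin n)     ≤⟨ count-disjoint p (_≡ᶠ x) (allFin n) disjoint ⟩
  count (λ y → p y ∨ (y ≡ᶠ x)) (allFin n)           ≤⟨ count-mono (allFin n) (λ {y} _ → merge y) ⟩
  count q (allFin n)                                ∎
  where
  open ≤-Reasoning
  disjoint : ∀ y → p y ≡ true → (y ≡ᶠ x) ≡ false
  disjoint y py = dec-false (y ≟ᶠ x) λ { refl → true≢false py ¬px }
  merge : ∀ y → p y ∨ (y ≡ᶠ x) ≡ true → q y ≡ true
  merge y eq with ∨-true (p y) eq
  ... | inj₁ py = h py
  ... | inj₂ yx with refl ← does-true (y ≟ᶠ x) yx = qx

unique-suffix : ∀ (xs : List X) {ys} → Unique (xs ++ ys) → Unique ys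
unique-suffix []       ys! = ys!
unique-suffix (x ∷ xs) xs! = unique-suffix xs (AllPairs.tail xs!)

separate : ∀ (h : X → Bool) xs → ∃₂ λ ys zs → (ys ++ zs ↭ xs) ×
  All (λ x → h x ≡ true) ys × All (λ x → h x ≡ false) zs
separate h [] = [] , [] , ↭-refl , [] , []
separate h (x ∷ xs) with ys , zs , σ , hy , hz ← separate h xs with h x in hx
... | true  = x ∷ ys , zs , ↭-prep x σ , hx ∷ hy , hz
... | false = ys , x ∷ zs , ↭-trans (Perm.shift x ys zs) (↭-prep x σ) , hy , hx ∷ hz

rotate-to : ∀ {y w : X} {ws} → y ∈ w ∷ ws → ∃ λ es → (y ∷ es ↭ w ∷ ws) × (pairs y es y ↭ pairs w ws w)
rotate-to (here refl) = _ , ↭-refl , ↭-refl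
rotate-to {y = y} {w} (there y∈) with as , bs , refl ← ∈-∃++ y∈ =
  bs ++ w ∷ as , rotate-list w as y bs , rotate-pairs w as y bs

-- Graphs on more than 2k + 1 vertices

module Wide {n} (k m : ℕ) (n≡ : n ≡ suc (k + m)) (2≤k : 2 ≤ k) (k<m : k < m) (G : SimpleGraph n)
  (A : Fin n → Bool) (count-A : count A (allFin n) ≡ k)
  (degree-A : ∀ {i} → A i ≡ true → degree G i ≡ k)
  (degree-B : ∀ {i} → A i ≡ false → m ≤ degree G i)
  (few : count (λ i → m <ᵇ degree G i) (allFin n) < k)
  (¬cycle : ¬ Cycle G (allFin n)) where

  V : List (Fin n)
  V = allFin n

  length-V : length V ≡ n
  length-V = length-tabulate (λ i → i)

  count-B : count (not ∘ A) V ≡ suc m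
  count-B = +-cancelˡ-≡ k _ _ (begin
    k + count (not ∘ A) V           ≡⟨ cong (_+ count (not ∘ A) V) count-A ⟨
    count A V + count (not ∘ A) V   ≡⟨ count-not A V ⟩
    length V                        ≡⟨ trans length-V n≡ ⟩
    suc (k + m)                     ≡⟨ +-suc k m ⟨
    k + suc m                       ∎)
    where open ≡-Reasoning

  2≤n : 2 ≤ n
  2≤n = ≤-trans 2≤k (≤-trans (m≤m+n k (suc m)) (≤-reflexive (trans (+-suc k m) (≡-sym n≡))))

  A≢B : ∀ {a b} → A a ≡ true → A b ≡ false → a ≢ b
  A≢B Aa Bb refl = true≢false Aa Bb

  -- The properties that survive every further round of the closure, so that the facts about hubs
  -- are available at each stage.
  record Extension (H : SimpleGraph n) : Set where
    field
      ⊇      : ∀ {i j} → adj G i j ≡ true → adj H i j ≡ true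
      clique : ∀ {i j} → A i ≡ false → A j ≡ false → i ≢ j → adj H i j ≡ true
      acyclic : ¬ Cycle H V

    degree-≥ : ∀ i → degree G i ≤ degree H i
    degree-≥ i = count-mono V (λ _ → ⊇)

    -- The clique outside A has m + 1 vertices and gives `b` m neighbours; `a` is one more.
    hub-degree : ∀ {a b} → A a ≡ true → A b ≡ false → adj H b a ≡ true → suc m ≤ degree H b
    hub-degree {a} {b} Aa Bb ba = ≤-pred (begin
      suc (suc m)                                  ≡⟨ cong suc count-B ⟨
      suc (count (not ∘ A) V)                      ≤⟨ count-subset-strict {x = a} (cong not Aa)
        (trans (cong (not (A a) ∨_) (≡ᶠ-refl a)) (∨-zeroʳ _)) (λ {y} By → cong (_∨ (y ≡ᶠ a)) By) ⟩
      count (λ y → not (A y) ∨ (y ≡ᶠ a)) V         ≤⟨ count-subset-insert b (λ {y} → neighbour y) ⟩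
      suc (degree H b)                             ∎)
      where
      open ≤-Reasoning
      neighbour : ∀ y → not (A y) ∨ (y ≡ᶠ a) ≡ true → y ≢ b → adj H b y ≡ true
      neighbour y eq y≢b with ∨-true (not (A y)) eq
      ... | inj₁ By = clique Bb (not-true By) (y≢b ∘ ≡-sym)
      ... | inj₂ ya with refl ← does-true (y ≟ᶠ a) ya = ba

    -- The degree sum of `b` and `a′` is at least (m + 1) + k = n.
    join : ∀ {a b a′} → A a ≡ true → A b ≡ false → adj H b a ≡ true → A a′ ≡ true → adj (stage H) b a′ ≡ true
    join {a} {b} {a′} Aa Bb ba Aa′ = stage-ore H (A≢B Aa′ Bb ∘ ≡-sym) (begin
      n                           ≡⟨ trans n≡ (cong suc (+-comm k m)) ⟩
      suc m + k                   ≤⟨ +-mono-≤ (hub-degree Aa Bb ba) (≤-trans (≤-reflexive (≡-sym (degree-A Aa′))) (degree-≥ a′)) ⟩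
      degree H b + degree H a′    ∎)
      where open ≤-Reasoning

  open Extension

  next : ∀ {H} → Extension H → Extension (stage H)
  next {H} E = record
    { ⊇       = stage-⊇ H ∘ ⊇ E
    ; clique  = λ Bi Bj i≢j → stage-⊇ H (clique E Bi Bj i≢j)
    ; acyclic = acyclic E ∘ stage-cycle H 2≤n
    }

  -- The first round makes the complement of A a clique and the second joins hubs to all of A. The
  -- last two serve the contradiction in `low-degree`.
  G₁ G₂ G₃ G₄ : SimpleGraph n
  G₁ = stage G
  G₂ = stage G₁
  G₃ = stage G₂
  G₄ = stage G₃

  E₁ : Extension G₁
  E₁ = record
    { ⊇       = stage-⊇ G
    -- The degree sum is at least 2m, and k < m gives 2m ≥ k + m + 1 = n.
    ; clique  = λ Bi Bj i≢j → stage-ore G i≢j (≤-trans (≤-reflexive n≡) (≤-trans (+-monoˡ-≤ m k<m) (+-mono-≤ (degree-B Bi) (degree-B Bj))))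
    ; acyclic = ¬cycle ∘ stage-cycle G 2≤n
    }

  E₂ : Extension G₂
  E₂ = next E₁

  E₄ : Extension G₄
  E₄ = next (next E₂)

  -- A vertex of A that gains a neighbour in G₂ is joined to everything outside A in G₃, so every vertex
  -- outside A has a neighbour in A and is joined to all of A in G₄, where Dirac's condition holds.
  low-degree : ∀ {a} → A a ≡ true → degree G₂ a ≤ k
  low-degree {a} Aa = ≮⇒≥ λ k<deg → acyclic E₄ (dirac G₄ V (suc m)
    (≤-trans 2≤n (≤-reflexive (≡-sym length-V)))
    (≤-trans (≤-reflexive (trans length-V n≡)) (s≤s (+-mono-≤ (<⇒≤ k<m) (n≤1+n m))))
    (λ {x} _ → large k<deg x))
    where
    all-joined : k < degree G₂ a → ∀ {a′ b} → A a′ ≡ true → A b ≡ false → adj G₄ b a′ ≡ true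
    all-joined k<deg {a′} {b} Aa′ Bb = join (next E₂) Aa Bb
      (trans (sym G₃ b a) (stage-ore G₂ (A≢B Aa Bb)
        (≤-trans (≤-reflexive n≡) (+-mono-≤ k<deg (≤-trans (degree-B Bb) (degree-≥ E₂ b)))))) Aa′
    large : k < degree G₂ a → ∀ x → suc m ≤ degree G₄ x
    large k<deg x with A x in Ax
    ... | false = hub-degree E₄ Aa Ax (all-joined k<deg Aa Ax)
    ... | true  = ≤-trans (≤-reflexive (≡-sym count-B))
      (count-mono V (λ {y} _ By → trans (sym G₄ x y) (all-joined k<deg Ax (not-true By))))

  -- The degree of `a` does not grow, so its neighbourhood does not either. This carries conclusions
  -- about the closure back to `G`.
  agree : ∀ {a x} → A a ≡ true → adj G₂ a x ≡ true → adj G a x ≡ true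
  agree {a} {x} Aa = count-rigid V (λ _ → ⊇ E₂)
    (≤-trans (low-degree Aa) (≤-reflexive (≡-sym (degree-A Aa)))) (∈-allFin x)

  some-A : ∃ λ a → a ∈ V × A a ≡ true
  some-A = count-∃ A V (≤-trans (≤-trans (s≤s z≤n) 2≤k) (≤-reflexive (≡-sym count-A)))

  a₀ : Fin n
  a₀ = proj₁ some-A

  Aa₀ : A a₀ ≡ true
  Aa₀ = proj₂ (proj₂ some-A)

  -- By `hub-joined` and `hub-intro`, a vertex outside A with one neighbour in A is adjacent to all
  -- of A, so testing a fixed `a₀` suffices.
  hub : Fin n → Bool
  hub b = not (A b) ∧ adj G a₀ b

  hub-joined : ∀ {a b} → A b ≡ false → adj G a₀ b ≡ true → A a ≡ true → adj G a b ≡ true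
  hub-joined {a} {b} Bb a₀b Aa = agree Aa (trans (sym G₂ a b)
    (join E₁ Aa₀ Bb (trans (sym G₁ b a₀) (⊇ E₁ a₀b)) Aa))

  hub-intro : ∀ {a b} → A b ≡ false → A a ≡ true → adj G a b ≡ true → adj G a₀ b ≡ true
  hub-intro {a} {b} Bb Aa ab = agree Aa₀ (trans (sym G₂ a₀ b)
    (join E₁ Aa Bb (trans (sym G₁ b a) (⊇ E₁ ab)) Aa₀))

  hub-elim : ∀ {b} → hub b ≡ true → A b ≡ false × adj G a₀ b ≡ true
  hub-elim {b} hb with ¬Ab , a₀b ← ∧-true (not (A b)) hb = not-true ¬Ab , a₀b

  s : ℕ
  s = count hub V

  s≤k : s ≤ k
  s≤k = ≤-trans (count-mono V (λ _ hb → proj₂ (hub-elim hb))) (≤-reflexive (degree-A Aa₀))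

  -- All neighbours of `w` lie outside A, where only m other vertices exist; as the degree is at
  -- least m, `w` is adjacent to all of them.
  module NonHub {w} (Bw : A w ≡ false) (a₀w : adj G a₀ w ≡ false) where

    inside : ∀ {y} → adj G w y ≡ true → A y ≡ false
    inside {y} wy with A y in Ay
    ... | false = refl
    ... | true  = ⊥-elim (true≢false (hub-intro Bw Ay (trans (sym G y w) wy)) a₀w)

    degree-≤ : degree G w ≤ m
    degree-≤ = ≤-pred (≤-trans (count-subset-strict {q = not ∘ A} (irref G w) (cong not Bw) (λ wy → cong not (inside wy))) (≤-reflexive count-B))

    ⊆B : ∀ v → adj G w v ∨ (v ≡ᶠ w) ≡ true → not (A v) ≡ true
    ⊆B v eq with ∨-true (adj G w v) eq
    ... | inj₁ wv = cong not (inside wv)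
    ... | inj₂ vw with refl ← does-true (v ≟ᶠ w) vw = cong not Bw

    count-≥ : count (not ∘ A) V ≤ count (λ v → adj G w v ∨ (v ≡ᶠ w)) V
    count-≥ = begin
      count (not ∘ A) V                          ≡⟨ count-B ⟩
      suc m                                      ≤⟨ s≤s (degree-B Bw) ⟩
      suc (degree G w)                           ≤⟨ count-subset-strict (irref G w)
        (trans (cong (adj G w w ∨_) (≡ᶠ-refl w)) (∨-zeroʳ _)) (λ {v} wv → cong (_∨ (v ≡ᶠ w)) wv) ⟩
      count (λ v → adj G w v ∨ (v ≡ᶠ w)) V       ∎
      where open ≤-Reasoning

    adjacent : ∀ {y} → A y ≡ false → y ≢ w → adj G w y ≡ true
    adjacent {y} By y≢w
      with ∨-true (adj G w y) (count-rigid V (λ {v} _ → ⊆B v) count-≥ (∈-allFin y) (cong not By))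
    ... | inj₁ wy = wy
    ... | inj₂ yw = contradiction (does-true (y ≟ᶠ w) yw) y≢w

  -- A hub is adjacent to all of A and to every non-hub outside A, so its non-neighbours, itself
  -- included, are hubs.
  hub-degree-G : ∀ {b} → hub b ≡ true → n ≤ degree G b + s
  hub-degree-G {b} hb = begin
    n                                        ≡⟨ length-V ⟨
    length V                                 ≡⟨ count-not (adj G b) V ⟨
    degree G b + count (not ∘ adj G b) V     ≤⟨ +-monoʳ-≤ (degree G b) (count-mono V (λ {y} _ → non-neighbour y)) ⟩
    degree G b + s                           ∎
    where
    open ≤-Reasoning
    Bb  = proj₁ (hub-elim hb)
    a₀b = proj₂ (hub-elim hb)
    non-neighbour : ∀ y → not (adj G b y) ≡ true → hub y ≡ true
    non-neighbour y ¬by with A y in Ay | adj G a₀ y in a₀y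
    ... | false | true  = refl
    ... | true  | _     = ⊥-elim (true≢false (trans (sym G b y) (hub-joined Bb a₀b Ay)) (not-true ¬by))
    ... | false | false = ⊥-elim (true≢false
      (trans (sym G b y) (NonHub.adjacent Ay a₀y Bb λ { refl → true≢false a₀b a₀y })) (not-true ¬by))

  -- From `s≤k` each hub has degree at least n - k = m + 1, and `few` bounds the number of such
  -- vertices.
  s<k : s < k
  s<k = ≤-<-trans (count-mono V λ {b} _ hb → Equivalence.to T-≡ (<⇒<ᵇ (+-cancelˡ-≤ k _ _ (begin
    k + suc m          ≡⟨ trans (+-suc k m) (≡-sym n≡) ⟩
    n                  ≤⟨ hub-degree-G hb ⟩
    degree G b + s     ≤⟨ +-monoʳ-≤ (degree G b) s≤k ⟩
    degree G b + k     ≡⟨ +-comm (degree G b) k ⟩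
    k + degree G b     ∎)))) few
    where open ≤-Reasoning

  -- Without hubs the k neighbours of `a₀` would lie among the k - 1 other vertices of A.
  some-hub : ∃ λ b → b ∈ V × hub b ≡ true
  some-hub with 0 <? s
  ... | yes 0<s = count-∃ hub V 0<s
  ... | no  ¬0<s = contradiction (≤-trans
    (count-subset-strict {q = A} (irref G a₀) Aa₀ (λ {y} → in-A y))
    (≤-reflexive (trans count-A (≡-sym (degree-A Aa₀))))) (<-irrefl refl)
    where
    in-A : ∀ y → adj G a₀ y ≡ true → A y ≡ true
    in-A y a₀y with A y in Ay
    ... | true  = refl
    ... | false = contradiction (count-∈ hub (∈-allFin y) (cong₂ (λ a c → not a ∧ c) Ay a₀y)) ¬0<s

  clique-path : ∀ {u v W} → A u ≡ false → A v ≡ false → u ≢ v → All (λ x → A x ≡ false) W →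
    All (u ≢_) W → All (v ≢_) W → Unique W → Path G₂ u W v
  clique-path Bu Bv u≢v []         []         []         []         = clique E₂ Bu Bv u≢v ∷ []
  clique-path Bu Bv u≢v (Bx ∷ BW) (u≢x ∷ _) (v≢x ∷ v∉) (x∉ ∷ W!) =
    clique E₂ Bu Bx u≢x ∷ clique-path Bx Bv (v≢x ∘ ≡-sym) BW x∉ v∉ W!

  -- With two hubs b and b′, Dirac's theorem gives a cycle through A and all hubs except b,
  -- into which b and the non-hubs outside A are inserted next to b′.
  two-hubs : ∀ {b b′} → hub b ≡ true → hub b′ ≡ true → b′ ≢ b → ⊥
  two-hubs {b} {b′} hb hb′ b′≢b
    -- `ys` receives A and the hubs except `b`; `zs` consists of `b` and the non-hubs outside A,
    -- later called `W`.
    with ys , zs , σ , ys-core , zs-rest ← separate (λ y → (A y ∨ hub y) ∧ not (y ≡ᶠ b)) V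
    with ∈-++⁻ ys (Perm.∈-resp-↭ (↭-sym σ) (∈-allFin b))
  ... | inj₁ b∈ys = ⊥-elim (true≢false (≡ᶠ-refl b) (not-true (proj₂ (∧-true (A b ∨ hub b) (All.lookup ys-core b∈ys)))))
  ... | inj₂ b∈zs with zs₁ , zs₂ , refl ← ∈-∃++ b∈zs = acyclic E₂ cycle
    where
    W = zs₁ ++ zs₂
    Bb  = proj₁ (hub-elim hb)
    Bb′ = proj₁ (hub-elim hb′)
    core : Fin n → Bool
    core y = A y ∨ hub y
    σ′ : ys ++ b ∷ W ↭ V
    σ′ = ↭-trans (Perm.++⁺ˡ ys (↭-sym (Perm.shift b zs₁ zs₂))) σ
    unique : Unique (b ∷ W)
    unique = unique-suffix ys (Unique-resp-↭ (≡-setoid (Fin n)) (↭⇒↭ₛ (↭-sym σ′)) (allFin⁺ n))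
    b∉W : All (b ≢_) W
    b∉W = AllPairs.head unique
    W-rest : ∀ {y} → y ∈ W → core y ≡ false
    W-rest {y} y∈ with core y in cy
    ... | false = refl
    ... | true  = ⊥-elim (true≢false
      (cong₂ _∧_ cy (cong not (dec-false (y ≟ᶠ b) (All.lookup b∉W y∈ ∘ ≡-sym))))
      (All.lookup zs-rest (Perm.∈-resp-↭ (↭-sym (Perm.shift b zs₁ zs₂)) (there y∈))))
    W-B : ∀ {y} → y ∈ W → A y ≡ false
    W-B {y} y∈ with A y | W-rest y∈
    ... | false | _ = refl
    W-nonhub : ∀ {y} → y ∈ W → hub y ≡ false
    W-nonhub {y} y∈ = trans (≡-sym (cong (_∨ hub y) (W-B y∈))) (W-rest y∈)
    W-nonadjacent : ∀ {a y} → A a ≡ true → y ∈ W → adj G₂ a y ≡ false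
    W-nonadjacent {a} {y} Aa y∈ with adj G₂ a y in ay
    ... | false = refl
    ... | true  = ⊥-elim (true≢false
      (cong₂ (λ c d → not c ∧ d) (W-B y∈) (hub-intro (W-B y∈) Aa (agree Aa ay))) (W-nonhub y∈))
    count-split : ∀ p → count p V ≡ count p ys + (⟦ p b ⟧ + count p W)
    count-split p = trans (count-↭ p (↭-sym σ′)) (count-++ p ys (b ∷ W))
    ys-core′ : ∀ {y} → y ∈ ys → core y ≡ true × y ≢ b
    ys-core′ {y} y∈ with cy , y≠b ← ∧-true (core y) (All.lookup ys-core y∈) =
      cy , λ { refl → true≢false (≡ᶠ-refl y) (not-true y≠b) }

    count-A-ys : count A ys ≡ k
    count-A-ys = trans (≡-sym (trans (count-split A) (trans
      (cong₂ (λ c d → count A ys + (⟦ c ⟧ + d)) Bb (count-none A W W-B)) (+-identityʳ _)))) count-A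

    length-ys : suc (length ys) ≤ k + s
    length-ys = begin
      suc (length ys)                              ≡⟨ +-comm 1 _ ⟩
      length ys + 1                                ≡⟨ cong₂ _+_ (≡-sym (count-all core ys (proj₁ ∘ ys-core′)))
                                                       (cong ⟦_⟧ (≡-sym (trans (cong (A b ∨_) hb) (∨-zeroʳ _)))) ⟩
      count core ys + ⟦ core b ⟧                   ≤⟨ +-monoʳ-≤ (count core ys) (m≤m+n _ _) ⟩
      count core ys + (⟦ core b ⟧ + count core W)  ≡⟨ count-split core ⟨
      count core V                                 ≤⟨ count-∨ A hub V ⟩
      count A V + s                                ≡⟨ cong (_+ s) count-A ⟩
      k + s                                        ∎
      where open ≤-Reasoning

    -- Leaving out `b` costs a vertex of A at most one neighbour, so k - 1 is the Dirac bound; s ≤ k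
    -- - 1 makes `ys` small enough, at most 2(k - 1) vertices.
    t : ℕ
    t = pred k
    k≡ : k ≡ suc t
    k≡ = ≡-sym (suc-pred k {{>-nonZero (≤-trans (s≤s z≤n) 2≤k)}})

    degree-ys : ∀ {x} → x ∈ ys → t ≤ count (adj G₂ x) ys
    degree-ys {x} x∈ with A x in Ax
    ... | true  = ≤-pred (begin
      suc t                         ≡⟨ k≡ ⟨
      k                             ≡⟨ degree-A Ax ⟨
      degree G x                    ≤⟨ degree-≥ E₂ x ⟩
      degree G₂ x                   ≡⟨ count-split (adj G₂ x) ⟩
      count (adj G₂ x) ys + (⟦ adj G₂ x b ⟧ + count (adj G₂ x) W)
        ≤⟨ +-monoʳ-≤ (count (adj G₂ x) ys) (+-mono-≤ (⟦⟧-mono {adj G₂ x b} {true} (const refl))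
             (≤-reflexive (count-none (adj G₂ x) W (W-nonadjacent Ax)))) ⟩
      count (adj G₂ x) ys + 1       ≡⟨ +-comm _ 1 ⟩
      suc (count (adj G₂ x) ys)     ∎)
      where open ≤-Reasoning
    ... | false = begin
      t                             ≤⟨ n≤1+n t ⟩
      suc t                         ≡⟨ trans (≡-sym k≡) (≡-sym count-A-ys) ⟩
      count A ys                    ≤⟨ count-mono ys (λ {a} _ Aa → trans (sym G₂ x a) (⊇ E₂ (hub-joined Ax
                                         (proj₂ (∧-true (not (A x)) (trans (≡-sym (cong (_∨ hub x) Ax)) (proj₁ (ys-core′ x∈))))) Aa))) ⟩
      count (adj G₂ x) ys           ∎
      where open ≤-Reasoning

    b-adjacent : ∀ {x} → x ∈ ys → adj G₂ b x ≡ true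
    b-adjacent {x} x∈ with A x in Ax
    ... | true  = trans (sym G₂ b x) (⊇ E₂ (hub-joined Bb (proj₂ (hub-elim hb)) Ax))
    ... | false = clique E₂ Bb Ax (proj₂ (ys-core′ x∈) ∘ ≡-sym)

    b′∈ys : b′ ∈ ys
    b′∈ys with ∈-++⁻ ys (Perm.∈-resp-↭ (↭-sym σ′) (∈-allFin b′))
    ... | inj₁ b′∈         = b′∈
    ... | inj₂ (here eq)   = contradiction eq b′≢b
    ... | inj₂ (there b′∈) = ⊥-elim (true≢false hb′ (W-nonhub b′∈))

    core-cycle : Cycle G₂ ys
    core-cycle = dirac G₂ ys t
      (≤-trans 2≤k (≤-trans (≤-reflexive (≡-sym count-A-ys)) (count≤length A ys)))
      (≤-pred (≤-trans length-ys (+-mono-≤ (≤-reflexive k≡) (≤-pred (≤-trans s<k (≤-reflexive k≡))))))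
      degree-ys

    cycle : Cycle G₂ V
    cycle with w , ws , τ , path ← core-cycle
      with es , υ , ρ ← rotate-to (Perm.∈-resp-↭ (↭-sym τ) b′∈ys) =
      -- From `b′` the clique leads through `W` to `b`, which is adjacent to all of `ys` and so can
      -- continue along the core cycle in place of `b′`.
      b′ , W ++ b ∷ es , ↭-trans perm σ′ ,
      path-++ G₂ b′ W es
        (clique-path Bb′ Bb b′≢b (All.tabulate W-B)
          (All.tabulate λ y∈ → λ { refl → true≢false hb′ (W-nonhub y∈) }) b∉W (AllPairs.tail unique))
        (replace-start G₂ es (All.tabulate λ x∈ → b-adjacent
          (Perm.∈-resp-↭ (↭-trans (↭-trans (↭-sym (Perm.∷↭∷ʳ b′ es)) υ) τ) x∈)) (Perm.All-resp-↭ (↭-sym ρ) path))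
      where
      perm : b′ ∷ W ++ b ∷ es ↭ ys ++ b ∷ W
      perm = begin
        b′ ∷ W ++ b ∷ es       ↭⟨ ↭-prep b′ (Perm.++-comm W (b ∷ es)) ⟩
        b′ ∷ b ∷ es ++ W       ↭⟨ ↭-prep b′ (Perm.shift b es W) ⟨
        (b′ ∷ es) ++ b ∷ W     ↭⟨ Perm.++⁺ʳ (b ∷ W) (↭-trans υ τ) ⟩
        ys ++ b ∷ W            ∎
        where open PermutationReasoning

  exceptional : ∃ λ b → k + m ≤ degree G b × (∀ i → i ≢ b → degree G i ≤ m)
  exceptional with b , _ , hb ← some-hub = b , ≤-pred (begin
      suc (k + m)          ≡⟨ n≡ ⟨
      n                    ≤⟨ hub-degree-G hb ⟩
      degree G b + s       ≤⟨ +-monoʳ-≤ (degree G b) (≤-trans (count-mono V only-hub) (count-single b (allFin⁺ n))) ⟩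
      degree G b + 1       ≡⟨ +-comm (degree G b) 1 ⟩
      suc (degree G b)     ∎) , others
    where
    open ≤-Reasoning
    only-hub : ∀ {y} → y ∈ V → hub y ≡ true → (y ≡ᶠ b) ≡ true
    only-hub {y} _ hy with y ≟ᶠ b
    ... | yes _  = refl
    ... | no y≢b = ⊥-elim (two-hubs hb hy y≢b)
    others : ∀ i → i ≢ b → degree G i ≤ m
    others i i≢b with A i in Ai | adj G a₀ i in a₀i
    ... | true  | _     = ≤-trans (≤-reflexive (degree-A Ai)) (<⇒≤ k<m)
    ... | false | false = NonHub.degree-≤ Ai a₀i
    ... | false | true  = ⊥-elim (two-hubs hb (cong₂ (λ c d → not c ∧ d) Ai a₀i) i≢b)

-- Reading the degree sequence and locating the exceptional vertex

count-below : ∀ k → k ≤ n → count (λ i → toℕ i <ᵇ k) (allFin n) ≡ k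
count-below {n}     zero    _         = count-none _ (allFin n) (λ _ → refl)
count-below {suc n} (suc k) (s≤s k≤n) = cong suc (begin
  count below (tabulate fsuc)                ≡⟨ cong (count below) (map-tabulate (λ i → i) fsuc) ⟨
  count below (map fsuc (allFin n))          ≡⟨ count-map below fsuc (allFin n) ⟩
  count (λ i → toℕ i <ᵇ k) (allFin n)        ≡⟨ count-below k k≤n ⟩
  k                                          ∎)
  where
  open ≡-Reasoning
  below : Fin (suc n) → Bool
  below i = toℕ i <ᵇ suc k

<ᵇ-false⇒≥ : ∀ {m n} → (m <ᵇ n) ≡ false → n ≤ m
<ᵇ-false⇒≥ eq = ≮⇒≥ λ lt → true≢false (Equivalence.to T-≡ (<⇒<ᵇ lt)) eq

<ᵇ-true⇒< : ∀ {m n} → (m <ᵇ n) ≡ true → m < n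
<ᵇ-true⇒< eq = <ᵇ⇒< _ _ (Equivalence.from T-≡ eq)

degree<n : ∀ (G : SimpleGraph n) i → degree G i < n
degree<n {n} G i = ≤-trans (count-∉ (adj G i) (∈-allFin i) (irref G i)) (≤-reflexive (length-tabulate {n = n} (λ j → j)))

-- The cases k < m and k = m meet in the same conclusion about degrees, which is all that the
-- sequence can see.
exceptional-vertex : ∀ k m → 2 ≤ k → k ≤ m → (G : SimpleGraph (suc (k + m))) →
  (∀ i → toℕ i < k → degree G i ≡ k) → (∀ i → k ≤ toℕ i → m ≤ degree G i) →
  (∀ i → toℕ i ≤ suc m → degree G i ≤ m) → ¬ Cycle G (allFin (suc (k + m))) →
  ∃ λ b → k + m ≤ degree G b × (∀ i → i ≢ b → degree G i ≤ m)
exceptional-vertex k m 2≤k k≤m G low high middle ¬cycle = analyse (k <? m)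
  where
  N = suc (k + m)
  tail-count : suc (suc m) + count (not ∘ (λ i → toℕ i <ᵇ suc (suc m))) (allFin N) ≡ N
  tail-count = trans (cong (_+ count (not ∘ (λ i → toℕ i <ᵇ suc (suc m))) (allFin N))
      (≡-sym (count-below (suc (suc m)) (s≤s (+-monoˡ-≤ m (≤-trans (s≤s z≤n) 2≤k))))))
    (trans (count-not (λ i → toℕ i <ᵇ suc (suc m)) (allFin N)) (length-tabulate {n = N} (λ i → i)))
  in-tail : ∀ i → (m <ᵇ degree G i) ≡ true → not (toℕ i <ᵇ suc (suc m)) ≡ true
  in-tail i hi with toℕ i <ᵇ suc (suc m) in eq
  ... | false = refl
  ... | true  = contradiction (<ᵇ-true⇒< hi) (≤⇒≯ (middle i (≤-pred (<ᵇ-true⇒< eq))))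
  -- A degree above m needs an index above m + 1, and k - 1 of the k + m + 1 indices are that large.
  few : count (λ i → m <ᵇ degree G i) (allFin N) < k
  few = ≤-trans (s≤s (count-mono (allFin N) (λ {i} _ → in-tail i)))
    (≤-reflexive (+-cancelˡ-≡ (suc m) _ _ (trans (+-suc (suc m) _) (trans tail-count (cong suc (+-comm k m))))))
  analyse : Dec (k < m) → ∃ λ b → k + m ≤ degree G b × (∀ i → i ≢ b → degree G i ≤ m)
  analyse (yes k<m) = Wide.exceptional k m refl 2≤k k<m G (λ i → toℕ i <ᵇ k)
    (count-below k (≤-trans (m≤m+n k m) (n≤1+n _))) (λ {i} lt → low i (<ᵇ-true⇒< lt))
    (λ {i} ge → high i (<ᵇ-false⇒≥ ge)) few ¬cycle
  analyse (no k≮m) with refl ← ≤-antisym k≤m (≮⇒≥ k≮m) =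
    Tight.exceptional k G (≤-trans (s≤s z≤n) 2≤k) min-degree few ¬cycle
    where
    min-degree : ∀ i → k ≤ degree G i
    min-degree i with toℕ i <? k
    ... | yes i<k = ≤-reflexive (≡-sym (low i i<k))
    ... | no  i≮k = high i (≮⇒≥ i≮k)

theorem2p3 : (n k : ℕ) → 5 ≤ n → 2 ≤ k → 2 * k < n →
    (π : Fin n → ℕ) → Graphical π → Nondecreasing π →
    (∀ i → toℕ i < k → π i ≡ k) →
    (∀ i → k ≤ toℕ i → toℕ i ≤ n ∸ k → π i ≡ n ∸ k ∸ 1) →
    ¬ ((∀ i → n ∸ k + 1 ≤ toℕ i → toℕ i ≤ n ∸ 2 → π i ≡ n ∸ k ∸ 1)
    × (∀ i → toℕ i ≡ n ∸ 1 → π i ≡ n ∸ 1)) →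
    ForciblyHamiltonian π
theorem2p3 n k 5≤n 2≤k 2k<n π _ mono low flat ¬exc G degrees
  -- Here m is n - k - 1, the second value of the sequence.
  with m , refl ← m≤n⇒∃[o]m+o≡n (≤-<-trans (m≤m+n k (k + 0)) 2k<n)
  with cycle? G (allFin (suc (k + m)))
... | yes cycle = cycle⇒hamiltonian G (≤-trans (s≤s (s≤s (s≤s z≤n))) 5≤n) cycle
... | no ¬cycle = ⊥-elim (¬exc (constant , top))
  where
  n∸k : suc (k + m) ∸ k ≡ suc m
  n∸k = trans (cong (_∸ k) (≡-sym (+-suc k m))) (m+n∸m≡n k (suc m))
  n∸k∸1 : suc (k + m) ∸ k ∸ 1 ≡ m
  n∸k∸1 = cong (_∸ 1) n∸k
  k≤m : k ≤ m
  k≤m = +-cancelˡ-≤ k _ _ (≤-trans (≤-reflexive (cong (k +_) (≡-sym (+-identityʳ k)))) (≤-pred 2k<n))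
  flat′ : ∀ i → k ≤ toℕ i → toℕ i ≤ suc m → π i ≡ m
  flat′ i k≤i i≤ = trans (flat i k≤i (≤-trans i≤ (≤-reflexive (≡-sym n∸k)))) n∸k∸1
  k<n : k < suc (k + m)
  k<n = s≤s (m≤m+n k m)
  high : ∀ i → k ≤ toℕ i → m ≤ π i
  high i k≤i = ≤-trans
    (≤-reflexive (≡-sym (flat′ (fromℕ< k<n) (≤-reflexive (≡-sym (toℕ-fromℕ< k<n)))
      (≤-trans (≤-reflexive (toℕ-fromℕ< k<n)) (≤-trans k≤m (n≤1+n m))))))
    (mono (fromℕ< k<n) i (≤-trans (≤-reflexive (toℕ-fromℕ< k<n)) k≤i))
  middle : ∀ i → toℕ i ≤ suc m → π i ≤ m
  middle i i≤ with toℕ i <? k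
  ... | yes i<k = ≤-trans (≤-reflexive (low i i<k)) k≤m
  ... | no  i≮k = ≤-reflexive (flat′ i (≮⇒≥ i≮k) i≤)
  exceptional : ∃ λ b → k + m ≤ degree G b × (∀ i → i ≢ b → degree G i ≤ m)
  exceptional = exceptional-vertex k m 2≤k k≤m G
    (λ i i<k → trans (degrees i) (low i i<k))
    (λ i k≤i → ≤-trans (high i k≤i) (≤-reflexive (≡-sym (degrees i))))
    (λ i i≤ → ≤-trans (≤-reflexive (degrees i)) (middle i i≤)) ¬cycle
  b = proj₁ exceptional
  ℓ : Fin (suc (k + m))
  ℓ = fromℕ< (n<1+n (k + m))
  toℕ-ℓ : toℕ ℓ ≡ k + m
  toℕ-ℓ = toℕ-fromℕ< (n<1+n (k + m))
  others : ∀ i → i ≢ b → π i ≤ m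
  others i i≢b = ≤-trans (≤-reflexive (≡-sym (degrees i))) (proj₂ (proj₂ exceptional) i i≢b)
  top-≥ : k + m ≤ π ℓ
  top-≥ = begin
    k + m        ≤⟨ proj₁ (proj₂ exceptional) ⟩
    degree G b   ≡⟨ degrees b ⟩
    π b          ≤⟨ mono b ℓ (≤-trans (≤-pred (toℕ<n b)) (≤-reflexive (≡-sym toℕ-ℓ))) ⟩
    π ℓ          ∎
    where open ≤-Reasoning
  -- The last entry is at least k + m > m, whereas every vertex other than `b` has degree at most m.
  ℓ≡b : ℓ ≡ b
  ℓ≡b with ℓ ≟ᶠ b
  ... | yes eq = eq
  ... | no ℓ≢b = contradiction (≤-trans (+-monoˡ-≤ m (≤-trans (s≤s z≤n) 2≤k)) (≤-trans top-≥ (others ℓ ℓ≢b))) (<-irrefl refl)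
  constant : ∀ i → suc (k + m) ∸ k + 1 ≤ toℕ i → toℕ i ≤ suc (k + m) ∸ 2 → π i ≡ suc (k + m) ∸ k ∸ 1
  constant i i≥ i≤ = trans (≤-antisym (others i i≢b) (high i k≤i)) (≡-sym n∸k∸1)
    where
    k≤i : k ≤ toℕ i
    k≤i = ≤-trans k≤m (≤-trans (n≤1+n m) (≤-trans (≤-reflexive (≡-sym n∸k)) (≤-trans (m≤m+n _ 1) i≥)))
    i≢b : i ≢ b
    i≢b refl = <-irrefl (trans (≡-sym (cong toℕ ℓ≡b)) toℕ-ℓ)
      (≤-<-trans i≤ (pred-< (≤-trans (≤-trans (s≤s z≤n) 2≤k) (m≤m+n k m))))
      where
      pred-< : ∀ {x} → 1 ≤ x → x ∸ 1 < x
      pred-< (s≤s _) = ≤-refl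
  top : ∀ i → toℕ i ≡ suc (k + m) ∸ 1 → π i ≡ suc (k + m) ∸ 1
  top i i≡ = ≤-antisym
    (≤-pred (≤-trans (s≤s (≤-reflexive (≡-sym (degrees i)))) (degree<n G i)))
    (≤-trans top-≥ (≤-reflexive (cong π (toℕ-injective (trans toℕ-ℓ (≡-sym i≡))))))
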